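{- Let $k\geq 3$ and $n\geq 2k+1$. Let $S$ be a vertex cut of the Kneser graph $K(n,k)$ and let $c=c(K(n,k)\setminus S)$. Then either $$\binom{n-k-1}{k-1}+1\leq c\leq \binom{n-1}{k-1}-\binom{n-k-1}{k-1}+1,$$ or $$\frac{|S|}{c}\geq \frac{n}{k}-1,$$ with equality if and only if $S$ is the complement of a maximum independent set of $K(n,k)$.
   Context: The Kneser graph $K(n,k)$ has as vertices the $k$-element subsets of $[n]=\{1,\dots,n\}$, two vertices adjacent iff the subsets are disjoint. A vertex cut is a set $S$ of vertices whose removal disconnects the graph; $c(K(n,k)\setminus S)$ is the number of connected components after deleting $S$. -}

module Defs where

open import Data.Nat using (ℕ; zero; suc; _≤_; _≟_)
open import Data.Bool using (Bool; true; false; not)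
open import Data.Fin using (Fin)
open import Data.Fin.Subset using (Subset; ∣_∣; _∩_; Empty)
open import Data.Vec using (Vec; []; _∷_; lookup)
open import Data.List using (List; []; _∷_; map; _++_; filter; length)
open import Data.Product using (Σ; ∃; ∃-syntax; _×_)
open import Relation.Binary.PropositionalEquality using (_≡_; _≢_)
open import Relation.Nullary using (¬_)

allSubsets : (n : ℕ) → List (Subset n)
allSubsets zero = [] ∷ []
allSubsets (suc n) = map (true ∷_) (allSubsets n) ++ map (false ∷_) (allSubsets n)

kSubsets : (n k : ℕ) → List (Subset n)
kSubsets n k = filter (λ p → ∣ p ∣ ≟ k) (allSubsets n)

-- A set of vertices of K(n,k), given by its indicator function
-- (only its values on k-subsets matter).
VSet : ℕ → Set
VSet n = Subset n → Bool

card : {n : ℕ} (k : ℕ) → VSet n → ℕ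
card {n} k S = length (filter (λ p → S p Data.Bool.≟ true) (kSubsets n k))

Adj : {n : ℕ} → Subset n → Subset n → Set
Adj p q = Empty (p ∩ q)

Remaining : {n : ℕ} (k : ℕ) → VSet n → Subset n → Set
Remaining k S p = ∣ p ∣ ≡ k × S p ≡ false

-- Walks in K(n,k) \ S (the start vertex is constrained separately).
data Walk {n : ℕ} (k : ℕ) (S : VSet n) : Subset n → Subset n → Set where
  here : ∀ {p} → Walk k S p p
  step : ∀ {p q r} → Remaining k S q → Adj p q → Walk k S q r → Walk k S p r

NumComponents : {n : ℕ} (k : ℕ) → VSet n → ℕ → Set
NumComponents {n} k S c =
  Σ (Vec (Subset n) c) λ reps →
    (∀ i → Remaining k S (lookup reps i)) ×
    (∀ i j → i ≢ j → ¬ Walk k S (lookup reps i) (lookup reps j)) ×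
    (∀ p → Remaining k S p → ∃[ i ] Walk k S p (lookup reps i))

IsVertexCut : {n : ℕ} (k : ℕ) → VSet n → Set
IsVertexCut k S =
  ∃[ p ] ∃[ q ] (Remaining k S p × Remaining k S q × ¬ Walk k S p q)

Independent : {n : ℕ} (k : ℕ) → VSet n → Set
Independent k I = ∀ p q → ∣ p ∣ ≡ k → ∣ q ∣ ≡ k → I p ≡ true → I q ≡ true → ¬ Adj p q

MaxIndependent : {n : ℕ} (k : ℕ) → VSet n → Set
MaxIndependent {n} k I = Independent k I × (∀ (J : VSet n) → Independent k J → card k J ≤ card k I)

IsComplOfMaxIndep : {n : ℕ} (k : ℕ) → VSet n → Set
IsComplOfMaxIndep {n} k S =
  ∃[ I ] (MaxIndependent k I × (∀ p → ∣ p ∣ ≡ k → S p ≡ not (I p)))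

{-# OPTIONS --safe #-}
module Submission where

open import Defs
open import Data.Nat using (ℕ; zero; suc; _≤_; _<_; _+_; _*_; _∸_; z≤n; s≤s; _≟_; _≤?_)
open import Data.Nat.Properties
open import Data.Nat.Combinatorics using (_C_; nCk+nC[k+1]≡[n+1]C[k+1])
open import Data.Nat.Tactic.RingSolver using (solve-∀)
open import Data.Bool using (Bool; true; false; not; _∧_; _∨_; if_then_else_)
import Data.Bool as Bool
import Data.Bool.Properties as Bool
open import Data.Fin using (Fin; zero; suc; punchIn)
import Data.Fin.Properties as Fin
open import Data.Fin.Subset using (Subset; ∣_∣; _∩_; Nonempty)
open import Data.Vec using ([]; _∷_; lookup; head; tail; _[_]=_; here; there)
open import Data.List using (List; []; _∷_; map; _++_; filter; length; allFin)
open import Data.List.Membership.Propositional using (_∈_)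
open import Data.List.Membership.Propositional.Properties using (∈-allFin)
open import Data.List.Relation.Unary.Any using (here; there)
open import Data.Product using (∃; ∃-syntax; _×_; _,_; proj₁; proj₂)
open import Data.Sum using (_⊎_; inj₁; inj₂; fromInj₂)
open import Data.Empty using (⊥; ⊥-elim)
open import Function using (_∘_; const)
open import Function.Bundles using (_⇔_; mk⇔)
open import Relation.Nullary using (¬_; Dec; yes; no; does)
open import Relation.Nullary.Decidable using (⌊_⌋; map′; _⊎-dec_; _×-dec_)
open import Relation.Binary.PropositionalEquality

-- Choosing one vertex per component of K(n,k) \ S gives an intersecting family of size c. Let
-- M = C(n-1,k-1) and X = C(n-k-1,k-1).
-- If no edge survives the deletion, then c = C(n,k) - |S| and Erdős–Ko–Rado gives c ≤ M, which is
-- the bound on |S|/c together with its equality case.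
-- If an edge uv survives and c ≤ X, split the surviving vertices into the component of uv and the
-- rest. The two parts are cross-intersecting, and a Hilton–Milner type bound for such pairs gives
-- |S| > C(n-k,k) = X (n-k)/k. When the rest is a single vertex this weakens to |S| ≥ C(n-k,k), but
-- then c = 2 < X.
-- If an edge uv survives and c > M - X + 1, the representatives form a star by Hilton–Milner. Its
-- centre is missing from u or from v, and that vertex meets all but one of the representatives,
-- so that c - 1 ≤ M - X, a contradiction.
-- Both intersection theorems are proved by shifting the first point of the ground set to the other
-- points and induction on n.

private variable
  a b c d j k m n o x y : ℕ

-- Binomial coefficients

bin : ℕ → ℕ → ℕ
bin _       zero    = 1
bin zero    (suc _) = 0
bin (suc n) (suc k) = bin n k + bin n (suc k)

bin≡C : ∀ n k → bin n k ≡ n C k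
bin≡C n       zero    = refl
bin≡C zero    (suc k) = refl
bin≡C (suc n) (suc k) = trans (cong₂ _+_ (bin≡C n k) (bin≡C n (suc k))) (nCk+nC[k+1]≡[n+1]C[k+1] n k)

bin-zero : n < k → bin n k ≡ 0
bin-zero {zero}  {suc k} _       = refl
bin-zero {suc n} {suc k} (s≤s p) = cong₂ _+_ (bin-zero p) (bin-zero (m<n⇒m<1+n p))

bin-pos : k ≤ n → 1 ≤ bin n k
bin-pos z≤n           = ≤-refl
bin-pos (s≤s {k} {n} p) = ≤-trans (bin-pos p) (m≤m+n (bin n k) _)

bin-diag : ∀ n → bin n n ≡ 1
bin-diag zero    = refl
bin-diag (suc n) = trans (cong₂ _+_ (bin-diag n) (bin-zero (n<1+n n))) refl

bin-one : ∀ n → bin n 1 ≡ n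
bin-one zero    = refl
bin-one (suc n) = cong suc (bin-one n)

-- The absorption identity, by Pascal's rule. It is what turns the ratio (n-k)/k of the theorem into
-- a relation between C(n-k,k) and C(n-k-1,k-1).
bin-absorb : ∀ n k → suc k * bin (suc n) (suc k) ≡ suc n * bin n k
bin-absorb n       zero    = trans (*-identityˡ _) (trans (bin-one (suc n)) (sym (*-identityʳ (suc n))))
bin-absorb zero    (suc k) = *-zeroʳ k
bin-absorb (suc n) (suc k) = begin
  suc (suc k) * (p + q)                     ≡⟨ e₁ k p q ⟩
  p + (suc k * p + suc (suc k) * q)         ≡⟨ cong (p +_) (cong₂ _+_ (bin-absorb n k) (bin-absorb n (suc k))) ⟩
  p + (suc n * bin n k + suc n * bin n (suc k)) ≡⟨ cong (p +_) (sym (*-distribˡ-+ (suc n) (bin n k) _)) ⟩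
  suc (suc n) * p                           ∎
  where
  open ≡-Reasoning
  p = bin (suc n) (suc k)
  q = bin (suc n) (suc (suc k))
  e₁ : ∀ k p q → suc (suc k) * (p + q) ≡ p + (suc k * p + suc (suc k) * q)
  e₁ = solve-∀

interchange : ∀ a b c d → (a + b) + (c + d) ≡ (a + c) + (b + d)
interchange = solve-∀

both : a + x ≤ m → b + y ≤ n → (a + b) + (x + y) ≤ m + n
both {a} {x} {m} {b} {y} p q = ≤-trans (≤-reflexive (interchange a b x y)) (+-mono-≤ p q)

swap-inner : ∀ a b c d → (a + b) + (c + d) ≡ (a + d) + (c + b)
swap-inner = solve-∀

-- Uniform families of subsets and their sizes

data Sub : ℕ → ℕ → Set where
  []  : Sub 0 0
  inn : Sub n k → Sub (suc n) (suc k)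
  out : Sub n k → Sub (suc n) k

-- The size n - k of the complement, without truncated subtraction.
outs : Sub n k → ℕ
outs []      = 0
outs (inn s) = outs s
outs (out s) = suc (outs s)

outs+k≡n : (s : Sub n k) → outs s + k ≡ n
outs+k≡n []              = refl
outs+k≡n (inn {k = k} s) = trans (+-suc (outs s) k) (cong suc (outs+k≡n s))
outs+k≡n (out s)         = cong suc (outs+k≡n s)

Family : ℕ → ℕ → Set
Family n k = Sub n k → Bool

-- The recursion on the first point runs parallel to Pascal's rule in `bin`. As the size is an index
-- of `Sub`, both sections of a uniform family are uniform again, and bounds on the sections add up
-- to a bound on the family.
cnt : Family n k → ℕ
cnt {zero}  {zero}  F = if F [] then 1 else 0
cnt {zero}  {suc k} F = 0
cnt {suc n} {zero}  F = cnt (F ∘ out)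
cnt {suc n} {suc k} F = cnt (F ∘ inn) + cnt (F ∘ out)

anySub? : {P : Sub n k → Set} → (∀ s → Dec (P s)) → Dec (∃ P)
anySub? {zero}  {zero}  P? = map′ ([] ,_) (λ { ([] , p) → p }) (P? [])
anySub? {zero}  {suc k} P? = no λ ()
anySub? {suc n} {zero}  P? = map′ (λ { (s , p) → out s , p }) (λ { (out s , p) → s , p }) (anySub? (P? ∘ out))
anySub? {suc n} {suc k} P? =
  map′ (λ { (inj₁ (s , p)) → inn s , p ; (inj₂ (s , p)) → out s , p })
       (λ { (inn s , p) → inj₁ (s , p) ; (out s , p) → inj₂ (s , p) })
       (anySub? (P? ∘ inn) ⊎-dec anySub? (P? ∘ out))

_≟ₛ_ : (s t : Sub n k) → Dec (s ≡ t)
[]    ≟ₛ []    = yes refl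
inn s ≟ₛ inn t = map′ (cong inn) (λ { refl → refl }) (s ≟ₛ t)
inn s ≟ₛ out t = no λ ()
out s ≟ₛ inn t = no λ ()
out s ≟ₛ out t = map′ (cong out) (λ { refl → refl }) (s ≟ₛ t)

true≢false : {A : Set} {x : Bool} → x ≡ true → x ≡ false → A
true≢false refl ()

cnt-mono : {F G : Family n k} → (∀ s → F s ≡ true → G s ≡ true) → cnt F ≤ cnt G
cnt-mono {zero} {zero} {F} {G} h with F [] in eq
... | false = z≤n
... | true rewrite h [] eq = ≤-refl
cnt-mono {zero}  {suc k} h = z≤n
cnt-mono {suc n} {zero}  h = cnt-mono (h ∘ out)
cnt-mono {suc n} {suc k} h = +-mono-≤ (cnt-mono (h ∘ inn)) (cnt-mono (h ∘ out))

cnt-cong : {F G : Family n k} → (∀ s → F s ≡ G s) → cnt F ≡ cnt G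
cnt-cong h = ≤-antisym (cnt-mono λ s e → trans (sym (h s)) e) (cnt-mono λ s e → trans (h s) e)

cnt-∧∨ : (F G : Family n k) → cnt (λ s → F s ∧ G s) + cnt (λ s → F s ∨ G s) ≡ cnt F + cnt G
cnt-∧∨ {zero} {zero} F G with F [] | G []
... | false | false = refl
... | false | true  = refl
... | true  | false = refl
... | true  | true  = refl
cnt-∧∨ {zero}  {suc k} F G = refl
cnt-∧∨ {suc n} {zero}  F G = cnt-∧∨ (F ∘ out) (G ∘ out)
cnt-∧∨ {suc n} {suc k} F G = trans
  (interchange (cnt λ s → F (inn s) ∧ G (inn s)) (cnt λ s → F (out s) ∧ G (out s)) _ _)
  (trans (cong₂ _+_ (cnt-∧∨ (F ∘ inn) (G ∘ inn)) (cnt-∧∨ (F ∘ out) (G ∘ out)))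
         (interchange (cnt (F ∘ inn)) (cnt (G ∘ inn)) _ _))

cnt-not : (F : Family n k) → cnt F + cnt (not ∘ F) ≡ bin n k
cnt-not {zero} {zero} F with F []
... | false = refl
... | true  = refl
cnt-not {zero}  {suc k} F = refl
cnt-not {suc n} {zero}  F = cnt-not (F ∘ out)
cnt-not {suc n} {suc k} F = trans (interchange (cnt (F ∘ inn)) _ _ _) (cong₂ _+_ (cnt-not (F ∘ inn)) (cnt-not (F ∘ out)))

cnt≤bin : (F : Family n k) → cnt F ≤ bin n k
cnt≤bin F = ≤-trans (m≤m+n _ _) (≤-reflexive (cnt-not F))

cnt-empty : {F : Family n k} → (∀ s → F s ≡ false) → cnt F ≡ 0
cnt-empty {zero}  {zero}  h rewrite h [] = refl
cnt-empty {zero}  {suc k} h = refl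
cnt-empty {suc n} {zero}  h = cnt-empty (h ∘ out)
cnt-empty {suc n} {suc k} h = cong₂ _+_ (cnt-empty (h ∘ inn)) (cnt-empty (h ∘ out))

find : (F : Family n k) → (∃[ s ] F s ≡ true) ⊎ (∀ s → F s ≡ false)
find F with anySub? (λ s → F s Bool.≟ true)
... | yes p = inj₁ p
... | no ¬p = inj₂ λ s → Bool.¬-not λ e → ¬p (s , e)

_∖_ : Family n k → Sub n k → Family n k
(F ∖ s) t with s ≟ₛ t
... | yes _ = false
... | no  _ = F t

∖-other : (F : Family n k) {s t : Sub n k} → s ≢ t → (F ∖ s) t ≡ F t
∖-other F {s} {t} ne with s ≟ₛ t
... | yes e = ⊥-elim (ne e)
... | no  _ = refl

∖⇒ : (F : Family n k) (s t : Sub n k) → (F ∖ s) t ≡ true → F t ≡ true × s ≢ t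
∖⇒ F s t e with s ≟ₛ t
∖⇒ F s t () | yes _
... | no ne = e , ne

cnt-∖ : (F : Family n k) (s : Sub n k) → F s ≡ true → cnt F ≡ suc (cnt (F ∖ s))
cnt-∖ F [] e rewrite e = refl
cnt-∖ F (inn s) e = cong₂ _+_
  (trans (cnt-∖ (F ∘ inn) s e) (cong suc (cnt-cong h)))
  (cnt-cong λ t → sym (∖-other F {inn s} {out t} λ ()))
  where
  h : ∀ t → ((F ∘ inn) ∖ s) t ≡ (F ∖ inn s) (inn t)
  h t with s ≟ₛ t
  ... | yes _ = refl
  ... | no  _ = refl
cnt-∖ {k = zero} F (out s) e = trans (cnt-∖ (F ∘ out) s e) (cong suc (cnt-cong h))
  where
  h : ∀ t → ((F ∘ out) ∖ s) t ≡ (F ∖ out s) (out t)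
  h t with s ≟ₛ t
  ... | yes _ = refl
  ... | no  _ = refl
cnt-∖ {k = suc _} F (out s) e = trans (cong₂ _+_
  (cnt-cong λ t → sym (∖-other F {out s} {inn t} λ ()))
  (trans (cnt-∖ (F ∘ out) s e) (cong suc (cnt-cong h)))) (+-suc (cnt ((F ∖ out s) ∘ inn)) _)
  where
  h : ∀ t → ((F ∘ out) ∖ s) t ≡ (F ∖ out s) (out t)
  h t with s ≟ₛ t
  ... | yes _ = refl
  ... | no  _ = refl

cnt-pos : (F : Family n k) (s : Sub n k) → F s ≡ true → 1 ≤ cnt F
cnt-pos F s e = ≤-trans (s≤s z≤n) (≤-reflexive (sym (cnt-∖ F s e)))

cnt-two : (F : Family n k) {s t : Sub n k} → F s ≡ true → F t ≡ true → s ≢ t → 2 ≤ cnt F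
cnt-two F {s} {t} e e′ ne =
  ≤-trans (s≤s (cnt-pos (F ∖ s) t (trans (∖-other F ne) e′))) (≤-reflexive (sym (cnt-∖ F s e)))

cnt⇒∃ : (F : Family n k) → 1 ≤ cnt F → ∃[ s ] F s ≡ true
cnt⇒∃ F p with find F
... | inj₁ q = q
... | inj₂ q = ⊥-elim (<⇒≢ p (sym (cnt-empty q)))

cnt⇒∃₂ : (F : Family n k) → 2 ≤ cnt F → ∃[ s ] ∃[ t ] (F s ≡ true × F t ≡ true × s ≢ t)
cnt⇒∃₂ F p with cnt⇒∃ F (≤-trans (n≤1+n 1) p)
... | s , e with cnt⇒∃ (F ∖ s) (≤-pred (≤-trans p (≤-reflexive (cnt-∖ F s e))))
...   | t , e′ = let (e″ , ne) = ∖⇒ F s t e′ in s , t , e , e″ , ne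

cnt-injective : (F : Family n k) (f : Fin c → Sub n k) → (∀ i → F (f i) ≡ true) →
  (∀ i j → f i ≡ f j → i ≡ j) → c ≤ cnt F
cnt-injective {c = zero}  F f h inj = z≤n
cnt-injective {c = suc c} F f h inj = ≤-trans
  (s≤s (cnt-injective (F ∖ f zero) (f ∘ suc)
    (λ i → trans (∖-other F (λ e → 0≢suc (inj zero (suc i) e))) (h (suc i)))
    (λ i j e → suc-inj (inj (suc i) (suc j) e))))
  (≤-reflexive (sym (cnt-∖ F (f zero) (h zero))))
  where
  0≢suc : ∀ {i : Fin c} → zero ≢ suc i
  0≢suc ()
  suc-inj : ∀ {i j : Fin c} → Fin.suc i ≡ suc j → i ≡ j
  suc-inj refl = refl

cnt-cover : (F : Family n k) (f : Fin c → Sub n k) → (∀ s → F s ≡ true → ∃[ i ] f i ≡ s) → cnt F ≤ c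
cnt-cover {c = zero} F f h with find F
... | inj₁ (s , e) with () ← proj₁ (h s e)
... | inj₂ q = ≤-reflexive (cnt-empty q)
cnt-cover {c = suc c} F f h with F (f zero) in eq
... | true = ≤-trans (≤-reflexive (cnt-∖ F (f zero) eq)) (s≤s (cnt-cover (F ∖ f zero) (f ∘ suc) g))
  where
  g : ∀ s → (F ∖ f zero) s ≡ true → ∃[ i ] f (suc i) ≡ s
  g s e with ∖⇒ F (f zero) s e
  ... | e′ , ne with h s e′
  ... | zero  , q = ⊥-elim (ne q)
  ... | suc i , q = i , q
-- Here `f zero` lies outside the family or repeats an element already removed, so it covers
-- nothing.
... | false = m≤n⇒m≤1+n (cnt-cover F (f ∘ suc) g)
  where
  g : ∀ s → F s ≡ true → ∃[ i ] f (suc i) ≡ s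
  g s e with h s e
  ... | zero  , refl = true≢false e eq
  ... | suc i , q    = i , q

-- Cross-intersecting families and sets meeting a given set

meets : Sub n a → Sub n b → Bool
meets []      []      = false
meets (inn s) (inn t) = true
meets (inn s) (out t) = meets s t
meets (out s) (inn t) = meets s t
meets (out s) (out t) = meets s t

meets-sym : (s : Sub n a) (t : Sub n b) → meets s t ≡ meets t s
meets-sym []      []      = refl
meets-sym (inn s) (inn t) = refl
meets-sym (inn s) (out t) = meets-sym s t
meets-sym (out s) (inn t) = meets-sym s t
meets-sym (out s) (out t) = meets-sym s t

meets-self : (s : Sub n (suc a)) → meets s s ≡ true
meets-self (inn s) = refl
meets-self (out s) = meets-self s

∅-misses : (s : Sub n 0) (t : Sub n b) → meets s t ≡ false
∅-misses []      []      = refl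
∅-misses (out s) (inn t) = ∅-misses s t
∅-misses (out s) (out t) = ∅-misses s t

Cross : Family n a → Family n b → Set
Cross A B = ∀ s t → A s ≡ true → B t ≡ true → meets s t ≡ true

Cross-∅ : {A : Family n 0} {B : Family n b} → Cross A B → 1 ≤ cnt A → 1 ≤ cnt B → ⊥
Cross-∅ {A = A} {B} h p q with cnt⇒∃ A p | cnt⇒∃ B q
... | s , e | t , e′ = true≢false (h s t e e′) (∅-misses s t)

-- The complement of a member of `B` is a k-set that misses this member, so it is not in `A`; hence
-- `A` and the complements of `B` are disjoint among the k-sets. Pairing `inn` sections with `out`
-- sections performs the complementation one point at a time.
cross-bound : k + j ≡ n → (A : Family n k) (B : Family n j) → Cross A B → cnt A + cnt B ≤ bin n k
cross-bound {zero} {zero} {zero} _ A B h with A [] in p | B [] in q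
... | false | false = z≤n
... | false | true  = ≤-refl
... | true  | false = ≤-refl
... | true  | true  with () ← h [] [] p q
cross-bound {zero} {suc j} {suc n} e A B h = ≤-trans
  (≤-trans (≤-reflexive (sym (+-assoc (cnt (A ∘ out)) _ _)))
    (+-mono-≤ (cross-bound (suc-injective e) (A ∘ out) (B ∘ inn) (λ s t → h (out s) (inn t)))
              (≤-trans (cnt≤bin (B ∘ out)) (≤-reflexive (bin-zero (≤-reflexive (sym e)))))))
  (≤-reflexive (+-identityʳ _))
cross-bound {suc k} {zero} {suc n} e A B h = ≤-trans
  (≤-reflexive (e₁ (cnt (A ∘ inn)) (cnt (A ∘ out)) (cnt (B ∘ out))))
  (+-mono-≤ (cross-bound (suc-injective e) (A ∘ inn) (B ∘ out) (λ s t → h (inn s) (out t)))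
            (cnt≤bin (A ∘ out)))
  where
  e₁ : ∀ x y z → (x + y) + z ≡ (x + z) + y
  e₁ = solve-∀
cross-bound {suc k} {suc j} {suc n} e A B h = ≤-trans
  (≤-reflexive (swap-inner (cnt (A ∘ inn)) (cnt (A ∘ out)) (cnt (B ∘ inn)) (cnt (B ∘ out))))
  (+-mono-≤ (cross-bound (suc-injective e) (A ∘ inn) (B ∘ out) (λ s t → h (inn s) (out t)))
            (≤-trans (≤-reflexive (+-comm (cnt (B ∘ inn)) _))
              (cross-bound (trans (sym (+-suc k j)) (suc-injective e)) (A ∘ out) (B ∘ inn) (λ s t → h (out s) (inn t)))))

-- The a-sets inside the complement of `t`, which has `outs t` points, are all excluded.
meet-bound : (F : Family n a) (t : Sub n c) → (∀ s → F s ≡ true → meets s t ≡ true) →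
  cnt F + bin (outs t) a ≤ bin n a
meet-bound {zero} {zero} F [] h with F [] in eq
... | false = ≤-refl
... | true with () ← h [] eq
meet-bound {zero}  {suc a} F []      h = ≤-refl
meet-bound {suc n} {zero}  F (inn t) h = meet-bound (F ∘ out) t (h ∘ out)
meet-bound {suc n} {zero}  F (out t) h = meet-bound (F ∘ out) t (h ∘ out)
meet-bound {suc n} {suc a} F (inn t) h = ≤-trans (≤-reflexive (+-assoc (cnt (F ∘ inn)) _ _))
  (+-mono-≤ (cnt≤bin (F ∘ inn)) (meet-bound (F ∘ out) t (h ∘ out)))
meet-bound {suc n} {suc a} F (out t) h =
  both {a = cnt (F ∘ inn)} (meet-bound (F ∘ inn) t (h ∘ inn)) (meet-bound (F ∘ out) t (h ∘ out))

full-unique : (s t : Sub n c) → outs s ≡ 0 → s ≡ t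
full-unique []      []      _ = refl
full-unique (inn s) (inn t) e = cong inn (full-unique s t e)
full-unique {c = suc k} (inn s) (out t) e = ⊥-elim (<-irrefl (subst (λ x → x + k ≡ _) e (outs+k≡n s))
  (≤-trans (m≤n+m (suc k) (outs t)) (≤-reflexive (outs+k≡n t))))

-- The sets missing `t` are excluded, which gives the first binomial. Fix a point of `t` outside
-- `u`: the sets through it that miss `u` are excluded too, and they meet `t`, so they are new; this
-- gives the second. The induction stops at the first point where `t` and `u` differ.
meet-bound₂ : (F : Family n (suc a)) (t u : Sub n c) → t ≢ u → outs t ≡ suc o → outs u ≡ suc o →
  (∀ s → F s ≡ true → meets s t ≡ true) → (∀ s → F s ≡ true → meets s u ≡ true) →
  cnt F + (bin (suc o) (suc a) + bin o a) ≤ bin n (suc a)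
meet-bound₂ F []      []      ne _ _ _ _ = ⊥-elim (ne refl)
meet-bound₂ F (inn t) (inn u) ne p q h h′ = ≤-trans (≤-reflexive (+-assoc (cnt (F ∘ inn)) _ _))
  (+-mono-≤ (cnt≤bin (F ∘ inn)) (meet-bound₂ (F ∘ out) t u (ne ∘ cong inn) p q (h ∘ out) (h′ ∘ out)))
meet-bound₂ {a = a} {o = o} F (inn t) (out u) ne p q h h′ = ≤-trans
  (≤-reflexive (cong (cnt (F ∘ inn) + cnt (F ∘ out) +_) (+-comm (bin (suc o) (suc a)) _)))
  (both {a = cnt (F ∘ inn)}
    (subst (λ z → cnt (F ∘ inn) + bin z a ≤ _) (suc-injective q) (meet-bound (F ∘ inn) u (h′ ∘ inn)))
    (subst (λ z → cnt (F ∘ out) + bin z (suc a) ≤ _) p (meet-bound (F ∘ out) t (h ∘ out))))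
meet-bound₂ {a = a} {o = o} F (out t) (inn u) ne p q h h′ = ≤-trans
  (≤-reflexive (cong (cnt (F ∘ inn) + cnt (F ∘ out) +_) (+-comm (bin (suc o) (suc a)) _)))
  (both {a = cnt (F ∘ inn)}
    (subst (λ z → cnt (F ∘ inn) + bin z a ≤ _) (suc-injective p) (meet-bound (F ∘ inn) t (h ∘ inn)))
    (subst (λ z → cnt (F ∘ out) + bin z (suc a) ≤ _) q (meet-bound (F ∘ out) u (h′ ∘ out))))
-- Each set misses a single point, and both miss the first one, so they would coincide.
meet-bound₂ {o = zero} F (out t) (out u) ne p q h h′ =
  ⊥-elim (ne (cong out (full-unique t u (suc-injective p))))
meet-bound₂ {a = zero} {o = suc o} F (out t) (out u) ne p q h h′ = ≤-trans
  (≤-reflexive (e (cnt (F ∘ inn)) (cnt (F ∘ out)) (bin (suc o) 1)))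
  (both {a = cnt (F ∘ inn)} (meet-bound (F ∘ inn) t (h ∘ inn))
    (meet-bound₂ (F ∘ out) t u (ne ∘ cong out) (suc-injective p) (suc-injective q) (h ∘ out) (h′ ∘ out)))
  where
  e : ∀ x y z → x + y + ((1 + z) + 1) ≡ x + y + (1 + (z + 1))
  e = solve-∀
meet-bound₂ {a = suc a} {o = suc o} F (out t) (out u) ne p q h h′ = ≤-trans
  (≤-reflexive (cong (cnt (F ∘ inn) + cnt (F ∘ out) +_) (interchange (bin (suc o) (suc a)) _ (bin o a) _)))
  (both {a = cnt (F ∘ inn)}
    (meet-bound₂ (F ∘ inn) t u (ne ∘ cong out) (suc-injective p) (suc-injective q) (h ∘ inn) (h′ ∘ inn))
    (meet-bound₂ (F ∘ out) t u (ne ∘ cong out) (suc-injective p) (suc-injective q) (h ∘ out) (h′ ∘ out)))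

-- Deleting a point, and stars

inAt : Fin (suc n) → Sub n k → Sub (suc n) (suc k)
inAt zero    s       = inn s
inAt (suc i) (inn s) = inn (inAt i s)
inAt (suc i) (out s) = out (inAt i s)

outAt : Fin (suc n) → Sub n k → Sub (suc n) k
outAt zero    s       = out s
outAt (suc i) (inn s) = inn (outAt i s)
outAt (suc i) (out s) = out (outAt i s)

-- Records whether `i` was present together with what is left after its deletion; the shift is
-- defined by cases on it.
data At (i : Fin (suc n)) : Sub (suc n) k → Set where
  isIn  : (r : Sub n k) → At i (inAt i r)
  isOut : (r : Sub n k) → At i (outAt i r)

view : (i : Fin (suc n)) (s : Sub (suc n) k) → At i s
view zero (inn s) = isIn s
view zero (out s) = isOut s
view {suc n} (suc i) (inn s) with view i s
... | isIn r  = isIn (inn r)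
... | isOut r = isOut (inn r)
view {suc n} (suc i) (out s) with view i s
... | isIn r  = isIn (out r)
... | isOut r = isOut (out r)

view-in : (i : Fin (suc n)) (r : Sub n k) → view i (inAt i r) ≡ isIn r
view-in zero    r       = refl
view-in (suc i) (inn r) rewrite view-in i r = refl
view-in (suc i) (out r) rewrite view-in i r = refl

view-out : (i : Fin (suc n)) (r : Sub n k) → view i (outAt i r) ≡ isOut r
view-out zero    r       = refl
view-out (suc i) (inn r) rewrite view-out i r = refl
view-out (suc i) (out r) rewrite view-out i r = refl

cnt-split₀ : (i : Fin (suc n)) (F : Family (suc n) 0) → cnt F ≡ cnt (F ∘ outAt i)
cnt-split₀ zero F = refl
cnt-split₀ {suc n} (suc i) F = cnt-split₀ i (F ∘ out)

cnt-split : (i : Fin (suc n)) (F : Family (suc n) (suc k)) → cnt F ≡ cnt (F ∘ inAt i) + cnt (F ∘ outAt i)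
cnt-split zero F = refl
cnt-split {suc n} {zero} (suc i) F = trans (cong₂ _+_ (cnt-split₀ i (F ∘ inn)) (cnt-split i (F ∘ out)))
  (e (cnt (F ∘ inn ∘ outAt i)) (cnt (F ∘ out ∘ inAt i)) _)
  where
  e : ∀ x y z → x + (y + z) ≡ y + (x + z)
  e = solve-∀
cnt-split {suc n} {suc k} (suc i) F = trans (cong₂ _+_ (cnt-split i (F ∘ inn)) (cnt-split i (F ∘ out)))
  (interchange (cnt (F ∘ inn ∘ inAt i)) _ _ _)

meets-in-in : (i : Fin (suc n)) (s : Sub n a) (t : Sub n b) → meets (inAt i s) (inAt i t) ≡ true
meets-in-in zero    s       t       = refl
meets-in-in (suc i) (inn s) (inn t) = refl
meets-in-in (suc i) (inn s) (out t) = meets-in-in i s t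
meets-in-in (suc i) (out s) (inn t) = meets-in-in i s t
meets-in-in (suc i) (out s) (out t) = meets-in-in i s t

meets-in-out : (i : Fin (suc n)) (s : Sub n a) (t : Sub n b) → meets (inAt i s) (outAt i t) ≡ meets s t
meets-in-out zero    s       t       = refl
meets-in-out (suc i) (inn s) (inn t) = refl
meets-in-out (suc i) (inn s) (out t) = meets-in-out i s t
meets-in-out (suc i) (out s) (inn t) = meets-in-out i s t
meets-in-out (suc i) (out s) (out t) = meets-in-out i s t

meets-out-out : (i : Fin (suc n)) (s : Sub n a) (t : Sub n b) → meets (outAt i s) (outAt i t) ≡ meets s t
meets-out-out zero    s       t       = refl
meets-out-out (suc i) (inn s) (inn t) = refl
meets-out-out (suc i) (inn s) (out t) = meets-out-out i s t
meets-out-out (suc i) (out s) (inn t) = meets-out-out i s t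
meets-out-out (suc i) (out s) (out t) = meets-out-out i s t

meets-out-in : (i : Fin (suc n)) (s : Sub n a) (t : Sub n b) → meets (outAt i s) (inAt i t) ≡ meets s t
meets-out-in i s t = trans (meets-sym (outAt i s) (inAt i t)) (trans (meets-in-out i t s) (meets-sym t s))

mem : Fin n → Sub n k → Bool
mem zero    (inn s) = true
mem zero    (out s) = false
mem (suc i) (inn s) = mem i s
mem (suc i) (out s) = mem i s

mem-in : (i : Fin (suc n)) (r : Sub n k) → mem i (inAt i r) ≡ true
mem-in zero    r       = refl
mem-in (suc i) (inn r) = mem-in i r
mem-in (suc i) (out r) = mem-in i r

mem-out : (i : Fin (suc n)) (r : Sub n k) → mem i (outAt i r) ≡ false
mem-out zero    r       = refl
mem-out (suc i) (inn r) = mem-out i r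
mem-out (suc i) (out r) = mem-out i r

mem-other : (i j : Fin (suc n)) (r : Sub n k) → i ≢ j → mem j (inAt i r) ≡ mem j (outAt i r)
mem-other zero    zero    r       ne = ⊥-elim (ne refl)
mem-other zero    (suc j) r       ne = refl
mem-other (suc i) zero    (inn r) ne = refl
mem-other (suc i) zero    (out r) ne = refl
mem-other (suc i) (suc j) (inn r) ne = mem-other i j r (ne ∘ cong suc)
mem-other (suc i) (suc j) (out r) ne = mem-other i j r (ne ∘ cong suc)

outs-outAt : (i : Fin (suc n)) (r : Sub n k) → outs (outAt i r) ≡ suc (outs r)
outs-outAt {n} {k} i r = +-cancelʳ-≡ k _ _ (trans (outs+k≡n (outAt i r)) (cong suc (sym (outs+k≡n r))))

Star : Fin n → Family n k → Set
Star i F = ∀ s → F s ≡ true → mem i s ≡ true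

-- The negation of `Star` in positive form, since the proofs work with the member that avoids the
-- centre.
NonStar : Fin n → Family n k → Set
NonStar i F = ∃[ s ] (F s ≡ true × mem i s ≡ false)

star? : (i : Fin n) (F : Family n k) → Star i F ⊎ NonStar i F
star? i F with anySub? (λ s → (F s Bool.≟ true) ×-dec (mem i s Bool.≟ false))
... | yes p = inj₂ p
... | no ¬p = inj₁ h
  where
  h : Star i F
  h s e with mem i s in q
  ... | true  = refl
  ... | false = ⊥-elim (¬p (s , e , q))

anyStar? : (F : Family n k) → (∃[ i ] Star i F) ⊎ (∀ i → NonStar i F)
anyStar? F with Fin.any? star-dec?
  where
  star-dec? : ∀ i → Dec (Star i F)
  star-dec? i with star? i F
  ... | inj₁ p           = yes p
  ... | inj₂ (s , e , q) = no λ h → true≢false (h s e) q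
... | yes p = inj₁ p
... | no ¬p = inj₂ h
  where
  h : ∀ i → NonStar i F
  h i with star? i F
  ... | inj₁ p = ⊥-elim (¬p (i , p))
  ... | inj₂ p = p

star-out : (i : Fin (suc n)) (F : Family (suc n) k) → Star i F → cnt (F ∘ outAt i) ≡ 0
star-out i F h = cnt-empty g
  where
  g : ∀ r → F (outAt i r) ≡ false
  g r with F (outAt i r) in e
  ... | false = refl
  ... | true  = true≢false (h _ e) (mem-out i r)

star-cnt : (i : Fin (suc n)) (F : Family (suc n) (suc k)) → Star i F → cnt F ≡ cnt (F ∘ inAt i)
star-cnt i F h = trans (cnt-split i F) (trans (cong (cnt (F ∘ inAt i) +_) (star-out i F h)) (+-identityʳ _))

star-bound : (i : Fin (suc n)) (F : Family (suc n) (suc k)) → Star i F → cnt F ≤ bin n k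
star-bound i F h = ≤-trans (≤-reflexive (star-cnt i F h)) (cnt≤bin (F ∘ inAt i))

-- Delete the centre: the members become k-sets on n points that still meet `t`, because `t` avoids
-- the centre, and only `d` of these points lie outside `t`.
star-meet-bound : (i : Fin (suc n)) (F : Family (suc n) (suc k)) (t : Sub (suc n) c) → Star i F →
  mem i t ≡ false → outs t ≡ suc d → (∀ s → F s ≡ true → meets s t ≡ true) → cnt F + bin d k ≤ bin n k
star-meet-bound {n = n} {k} {d = d} i F t h e q g with view i t
... | isIn r  = true≢false (mem-in i r) e
... | isOut r = subst₂ (λ x y → x + bin y k ≤ bin n k) (sym (star-cnt i F h))
  (suc-injective (trans (sym (outs-outAt i r)) q))
  (meet-bound (F ∘ inAt i) r λ s e → trans (sym (meets-in-out i s r)) (g _ e))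

-- Shifting

-- P and Q are the sections of a family at the head of the ground set: members with the head
-- deleted, resp. members avoiding the head. The shift replaces the head by i where possible.
Sections : ℕ → ℕ → Set
Sections n k = Family n k × Family n (suc k)

total : Sections n k → ℕ
total (P , Q) = cnt P + cnt Q

-- A member through the head stays if it already contains `i`, or if its image under the shift is
-- already occupied.
keep : Family (suc n) (suc k) → {i : Fin (suc n)} {s : Sub (suc n) k} → At i s → Bool
keep Q     (isIn _)  = true
keep Q {i} (isOut r) = Q (inAt i r)

gain : Family (suc n) k → {i : Fin (suc n)} {s : Sub (suc n) (suc k)} → At i s → Bool
gain P {i} (isIn r)  = P (outAt i r)
gain P     (isOut _) = false

shift : Fin (suc n) → Sections (suc n) k → Sections (suc n) k
shift i (P , Q) = (λ s → P s ∧ keep Q (view i s)) , (λ s → Q s ∨ gain P (view i s))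

Stable : Fin (suc n) → Sections (suc n) k → Set
Stable i (P , Q) = ∀ r → P (outAt i r) ≡ true → Q (inAt i r) ≡ true

∧-true : ∀ x {y} → x ∧ y ≡ true → x ≡ true × y ≡ true
∧-true true e = refl , e

module _ (i : Fin (suc n)) (X : Sections (suc n) k) where
  private
    P = proj₁ X
    Q = proj₂ X
    P′ = proj₁ (shift i X)
    Q′ = proj₂ (shift i X)

  shift-shrinks : ∀ s → P′ s ≡ true → P s ≡ true
  shift-shrinks s e = proj₁ (∧-true (P s) e)

  shift-grows : ∀ s → Q s ≡ true → Q′ s ≡ true
  shift-grows s e rewrite e = refl

  shift-P-out : ∀ r → P′ (outAt i r) ≡ P (outAt i r) ∧ Q (inAt i r)
  shift-P-out r rewrite view-out i r = refl

  -- The transport lets the successor size of `inAt i r` match the variable size `k` of `P`.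
  shift-P-in : ∀ (r : Sub n m) (e : suc m ≡ k) →
    P′ (subst (Sub (suc n)) e (inAt i r)) ≡ P (subst (Sub (suc n)) e (inAt i r))
  shift-P-in r refl rewrite view-in i r = Bool.∧-identityʳ _

  shift-Q-in : ∀ r → Q′ (inAt i r) ≡ Q (inAt i r) ∨ P (outAt i r)
  shift-Q-in r rewrite view-in i r = refl

  shift-Q-out : ∀ r → Q′ (outAt i r) ≡ Q (outAt i r)
  shift-Q-out r rewrite view-out i r = Bool.∨-identityʳ _

  shift-moves : ∀ r → P (outAt i r) ≡ true → Q′ (inAt i r) ≡ true
  shift-moves r e = trans (shift-Q-in r) (trans (cong (Q (inAt i r) ∨_) e) (Bool.∨-zeroʳ _))

  shift-Q-inv : ∀ s → Q′ s ≡ true → Q s ≡ true ⊎ ∃[ r ] (s ≡ inAt i r × P (outAt i r) ≡ true)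
  shift-Q-inv s e with Q s
  ... | true  = inj₁ refl
  ... | false with view i s
  ...   | isIn r  = inj₂ (r , refl , e)

  shift-stable : Stable i (shift i X)
  shift-stable r e = shift-grows _ (proj₂ (∧-true (P (outAt i r)) (trans (sym (shift-P-out r)) e)))

  shift-keeps-stable : ∀ j → Stable j X → Stable j (shift i X)
  shift-keeps-stable j h r e = shift-grows _ (h r (shift-shrinks _ e))

-- Only the pairs `outAt i r` in `P`, `inAt i r` in `Q` are affected, and there the two indicators
-- are replaced by their `∧` and `∨`; by `cnt-∧∨` the total stays the same.
shift-total : (i : Fin (suc n)) (X : Sections (suc n) k) → total (shift i X) ≡ total X
shift-total {k = k} i X@(P , Q) = begin
  cnt P′ + cnt Q′                                       ≡⟨ cong (cnt P′ +_) (cnt-split i Q′) ⟩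
  cnt P′ + (cnt (Q′ ∘ inAt i) + cnt (Q′ ∘ outAt i))     ≡⟨ cong₂ (λ x y → cnt P′ + (x + y)) (cnt-cong (shift-Q-in i X)) (cnt-cong (shift-Q-out i X)) ⟩
  cnt P′ + (cnt (λ r → Q (inAt i r) ∨ P (outAt i r)) + cnt (Q ∘ outAt i))
                                                        ≡⟨ sym (+-assoc (cnt P′) _ _) ⟩
  cnt P′ + cnt (λ r → Q (inAt i r) ∨ P (outAt i r)) + cnt (Q ∘ outAt i)
                                                        ≡⟨ cong (_+ cnt (Q ∘ outAt i)) (body k P Q) ⟩
  cnt P + cnt (Q ∘ inAt i) + cnt (Q ∘ outAt i)          ≡⟨ +-assoc (cnt P) _ _ ⟩
  cnt P + (cnt (Q ∘ inAt i) + cnt (Q ∘ outAt i))        ≡⟨ cong (cnt P +_) (sym (cnt-split i Q)) ⟩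
  cnt P + cnt Q                                         ∎
  where
  open ≡-Reasoning
  P′ = proj₁ (shift i X)
  Q′ = proj₂ (shift i X)
  out-part : ∀ {k} (P : Family _ k) Q → cnt (proj₁ (shift i (P , Q)) ∘ outAt i) + cnt (λ r → Q (inAt i r) ∨ P (outAt i r))
    ≡ cnt (P ∘ outAt i) + cnt (Q ∘ inAt i)
  out-part P Q = trans
    (cong₂ _+_ (cnt-cong λ r → trans (shift-P-out i (P , Q) r) (Bool.∧-comm (P (outAt i r)) _)) refl)
    (trans (cnt-∧∨ (Q ∘ inAt i) (P ∘ outAt i)) (+-comm (cnt (Q ∘ inAt i)) _))
  body : ∀ k (P : Family _ k) Q → cnt (proj₁ (shift i (P , Q))) + cnt (λ r → Q (inAt i r) ∨ P (outAt i r))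
    ≡ cnt P + cnt (Q ∘ inAt i)
  body zero P Q = trans (cong (_+ cnt (λ r → Q (inAt i r) ∨ P (outAt i r))) (cnt-split₀ i (proj₁ (shift i (P , Q)))))
    (trans (out-part P Q) (cong (_+ cnt (Q ∘ inAt i)) (sym (cnt-split₀ i P))))
  body (suc k) P Q = trans (cong (_+ cnt (λ r → Q (inAt i r) ∨ P (outAt i r))) (cnt-split i (proj₁ (shift i (P , Q)))))
    (trans (+-assoc (cnt (proj₁ (shift i (P , Q)) ∘ inAt i)) _ _)
      (trans (cong₂ _+_ (cnt-cong λ r → shift-P-in i (P , Q) r refl) (out-part P Q))
        (trans (sym (+-assoc (cnt (P ∘ inAt i)) (cnt (P ∘ outAt i)) _)) (cong (_+ cnt (Q ∘ inAt i)) (sym (cnt-split i P))))))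

-- Cross-intersection of the glued families. Members from `P` and `R` already share the head, so
-- this pair imposes no condition.
CrossS : Sections n a → Sections n b → Set
CrossS (P , Q) (R , T) = Cross P T × Cross Q R × Cross Q T

sections : Family (suc n) (suc k) → Sections n k
sections F = (F ∘ inn) , (F ∘ out)

CrossS-sections : {A : Family (suc n) (suc a)} {B : Family (suc n) (suc b)} → Cross A B → CrossS (sections A) (sections B)
CrossS-sections h = (λ s t → h (inn s) (out t)) , (λ s t → h (out s) (inn t)) , (λ s t → h (out s) (out t))

CrossS-sym : {X : Sections n a} {Y : Sections n b} → CrossS X Y → CrossS Y X
CrossS-sym (h₁ , h₂ , h₃) = flip′ h₂ , flip′ h₁ , flip′ h₃
  where
  flip′ : {A : Family n a} {B : Family n b} → Cross A B → Cross B A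
  flip′ h s t e e′ = trans (meets-sym s t) (h t s e′ e)

-- The critical case is a moved `t` and a kept `s` avoiding `i`. That `s` was kept means that its
-- image lies in `Q`, so the image meets the original of `t`; which of the two sets carries `i` does
-- not affect whether they meet.
shift-cross₁ : (i : Fin (suc n)) (X : Sections (suc n) a) (Y : Sections (suc n) b) → CrossS X Y →
  Cross (proj₁ (shift i X)) (proj₂ (shift i Y))
shift-cross₁ i X Y (h₁ , h₂ , h₃) s t e e′ with shift-Q-inv i Y t e′
... | inj₁ q = h₁ s t (shift-shrinks i X s e) q
... | inj₂ (r , refl , q) with view i s in v
...   | isIn p  = meets-in-in i p r
...   | isOut p = trans (meets-out-in i p r) (trans (sym (meets-in-out i p r))
        (h₂ _ _ (proj₂ (∧-true _ e)) q))

shift-cross : (i : Fin (suc n)) (X : Sections (suc n) a) (Y : Sections (suc n) b) → CrossS X Y →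
  CrossS (shift i X) (shift i Y)
shift-cross {n = n} {a} {b} i X Y h@(h₁ , h₂ , h₃) = shift-cross₁ i X Y h , flip″ , g
  where
  flip″ : Cross (proj₂ (shift i X)) (proj₁ (shift i Y))
  flip″ s t e e′ = trans (meets-sym s t) (shift-cross₁ i Y X (CrossS-sym {X = X} {Y = Y} h) t s e′ e)
  out⇒in : ∀ {x y} (s : Sub (suc n) x) (r : Sub n y) → meets s (outAt i r) ≡ true → meets s (inAt i r) ≡ true
  out⇒in s r e with view i s
  ... | isIn p  = meets-in-in i p r
  ... | isOut p = trans (meets-out-in i p r) (trans (sym (meets-out-out i p r)) e)
  g : Cross (proj₂ (shift i X)) (proj₂ (shift i Y))
  g s t e e′ with shift-Q-inv i X s e | shift-Q-inv i Y t e′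
  ... | inj₁ p | inj₁ q = h₃ s t p q
  ... | inj₁ p | inj₂ (r , refl , q) = out⇒in s r (h₂ _ _ p q)
  ... | inj₂ (r , refl , p) | inj₁ q = trans (meets-sym (inAt i r) t)
        (out⇒in t r (trans (meets-sym t (outAt i r)) (h₁ _ _ p q)))
  ... | inj₂ (r , refl , p) | inj₂ (r′ , refl , q) = meets-in-in i r r′

-- Stability is never destroyed by later shifts, so a single pass over all positions suffices.
compress : {X : Set} (sh : Fin n → X → X) (St : Fin n → X → Set) →
  (∀ i x → St i (sh i x)) → (∀ i j x → St j x → St j (sh i x)) →
  (H G : X → Set) → (∀ i x → H x → G x ⊎ (H (sh i x) × (G (sh i x) → G x))) →
  (∀ x → H x → (∀ i → St i x) → G x) → ∀ x → H x → G x
compress {n = n} {X} sh St new old H G advance base x h = go (allFin n) x h (λ i → inj₁ (∈-allFin i))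
  where
  go : (L : List (Fin n)) → ∀ x → H x → (∀ i → i ∈ L ⊎ St i x) → G x
  go [] x h st = base x h λ i → fromInj₂ (λ ()) (st i)
  go (i ∷ L) x h st with advance i x h
  -- The goal may be settled without shifting; Hilton-Milner uses this when the shift would create a
  -- star.
  ... | inj₁ g = g
  ... | inj₂ (h′ , back) = back (go L (sh i x) h′ st′)
    where
    st′ : ∀ j → j ∈ L ⊎ St j (sh i x)
    st′ j with st j
    ... | inj₁ (here refl) = inj₂ (new i x)
    ... | inj₁ (there p)   = inj₁ p
    ... | inj₂ p           = inj₂ (old i j x p)

-- Consequences of stability under all shifts

room : (s : Sub (suc n) a) (t : Sub (suc n) b) → b < outs s →
  ∃[ i ] ∃[ r ] (s ≡ outAt i r × (meets (inAt i r) t ≡ true → meets s t ≡ true))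
room {n = n} (out s) (out t) p = zero , s , refl , λ e → e
room {n = suc n} (inn s) (inn t) p with room s t (≤-trans (n≤1+n _) p)
... | i , r , refl , h = suc i , inn r , refl , λ _ → refl
room {n = suc n} (inn s) (out t) p with room s t p
... | i , r , refl , h = suc i , inn r , refl , h
room {n = suc n} (out s) (inn t) p with room s t (≤-pred p)
... | i , r , refl , h = suc i , out r , refl , h
room {n = zero} (inn []) t ()
room {n = zero} (out []) (inn []) (s≤s ())

an-out : (s : Sub (suc n) a) → 1 ≤ outs s → ∃[ i ] ∃[ r ] s ≡ outAt i r
an-out (out s) p = zero , s , refl
an-out {suc n} (inn s) p with an-out s p
... | i , r , refl = suc i , inn r , refl
an-out {zero} (inn []) ()

free : (j : Fin (suc n)) (s : Sub (suc n) a) → 2 ≤ outs s → ∃[ i ] ∃[ r ] (s ≡ outAt i r × i ≢ j)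
free {n = zero} j (out []) (s≤s ())
free {n = suc n} zero (inn s) p with free zero s p
... | i , r , refl , _ = suc i , inn r , refl , λ ()
free {n = suc n} zero (out s) p with an-out s (≤-pred p)
... | i , r , refl = suc i , out r , refl , λ ()
free {n = suc n} (suc j) (inn s) p with free j s p
... | i , r , refl , ne = suc i , inn r , refl , λ { refl → ne refl }
free {n = suc n} (suc j) (out s) p = zero , s , refl , λ ()
free {n = zero} j (inn []) ()

inAt-injective-pos : (i j : Fin (suc n)) (r s : Sub n k) → outAt i r ≡ outAt j s → inAt i r ≡ inAt j s → i ≡ j
inAt-injective-pos i j r s e e′ with i Fin.≟ j
... | yes p = p
... | no ne = true≢false (mem-in i r) (trans (cong (mem i) e′)
  (trans (mem-other j i s (ne ∘ sym)) (trans (cong (mem i) (sym e)) (mem-out i r))))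

outs≡ : (s : Sub n k) → n ≡ k + d → outs s ≡ d
outs≡ {k = k} s e = +-cancelˡ-≡ k _ _ (trans (+-comm k _) (trans (outs+k≡n s) e))

AllStable : Sections (suc n) k → Set
AllStable X = ∀ i → Stable i X

module _ {n k d} (e : suc n ≡ k + suc d) (X : Sections (suc n) k) (st : AllStable X) where
  private
    P = proj₁ X
    Q = proj₂ X

  -- A member of `P` misses d + 1 points, and adding any one of them gives a member of `Q`.
  stable-pos : 1 ≤ total X → 1 ≤ cnt Q
  stable-pos p with find P
  ... | inj₂ q = subst (1 ≤_) (cong (_+ cnt Q) (cnt-empty q)) p
  ... | inj₁ (s , ps) with an-out s (≤-trans (s≤s z≤n) (≤-reflexive (sym (outs≡ s e))))
  ...   | i , r , refl = cnt-pos Q _ (st i r ps)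

  stable-two : 1 ≤ d → 2 ≤ total X → 2 ≤ cnt Q
  stable-two 1≤d p with find P
  ... | inj₂ q = subst (2 ≤_) (cong (_+ cnt Q) (cnt-empty q)) p
  ... | inj₁ (s , ps) with an-out s (≤-trans (s≤s z≤n) (≤-reflexive (sym (outs≡ s e))))
  ...   | i , r , refl with free i (outAt i r) (≤-trans (s≤s 1≤d) (≤-reflexive (sym (outs≡ (outAt i r) e))))
  ...     | j , r′ , eq , ne = cnt-two Q (st i r ps) (st j r′ (subst (λ z → P z ≡ true) eq ps))
              λ q → ne (sym (inAt-injective-pos i j r r′ eq q))

  stable-nonStar : 1 ≤ d → ∀ i → (∃[ s ] (P s ≡ true × mem i s ≡ false)) ⊎ NonStar i Q → NonStar i Q
  stable-nonStar 1≤d i (inj₂ q) = q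
  stable-nonStar 1≤d i (inj₁ (s , ps , ms)) with free i s (≤-trans (s≤s 1≤d) (≤-reflexive (sym (outs≡ s e))))
  ... | j , r , refl , ne = inAt j r , st j r ps , trans (mem-other j i r ne) ms

  -- Two k-sets do not cover the k + d + 1 points, so `room` finds a point outside `s` and `t`.
  -- Adding it to `s` gives a member of `Q`, which meets `t`, and not in the added point.
  stable-cross : k ≤ d → (Y : Sections (suc n) k) → CrossS X Y → Cross P (proj₁ Y)
  stable-cross k≤d Y (_ , h , _) s t ps rt with room s t (≤-trans (s≤s k≤d) (≤-reflexive (sym (outs≡ s e))))
  ... | i , r , refl , back = back (h _ t (st i r ps) rt)

-- Hilton-Milner bounds for cross-intersecting pairs

merge : ∀ {a b c e x y m n} → a + c + x ≤ m → b + e + y ≤ n → (a + b) + (c + e) + (x + y) ≤ m + n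
merge {a} {b} {c} {e} {x} {y} p q = ≤-trans (≤-reflexive (eq a b c e x y)) (+-mono-≤ p q)
  where
  eq : ∀ a b c e x y → (a + b) + (c + e) + (x + y) ≡ (a + c + x) + (b + e + y)
  eq = solve-∀

cross-avoid : (A : Family n a) (B : Family n b) → Cross A B → n ≡ a + d → (t : Sub n a) → A t ≡ true →
  cnt B + bin d b ≤ bin n b
cross-avoid {n} {b = b} A B h e t at = subst (λ x → cnt B + bin x b ≤ bin n b) (outs≡ t e)
  (meet-bound B t λ s bs → trans (meets-sym s t) (h t s at bs))

-- If one of the sections through the head is empty, a member of the corresponding `out` section
-- excludes C(d,k) sets from the other. If both are nonempty, the inductive bound has C(d+1,k) in
-- place of C(d,k), and this gain of at least 1 absorbs the extra 1.
inn-bound : ∀ {n k d} → suc n ≡ k + suc d → k ≤ d → (X Y : Sections (suc n) k) →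
  CrossS X Y → Cross (proj₁ X) (proj₁ Y) → 1 ≤ cnt (proj₂ X) → 1 ≤ cnt (proj₂ Y) →
  (1 ≤ cnt (proj₁ X) → 1 ≤ cnt (proj₁ Y) → cnt (proj₁ X) + cnt (proj₁ Y) + bin (suc d) k ≤ suc (bin (suc n) k)) →
  cnt (proj₁ X) + cnt (proj₁ Y) + bin d k ≤ bin (suc n) k
inn-bound {n} {k} {d} e k≤d (P , Q) (R , T) (h₁ , h₂ , h₃) h₄ p q ih with find P | find R
... | inj₂ u | _ = subst (λ x → x + cnt R + bin d k ≤ bin (suc n) k) (sym (cnt-empty u))
  (let (t , qt) = cnt⇒∃ Q p in cross-avoid Q R h₂ (trans e (+-suc k d)) t qt)
... | inj₁ _ | inj₂ u = subst (λ x → x + bin d k ≤ bin (suc n) k)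
  (sym (trans (cong (cnt P +_) (cnt-empty u)) (+-identityʳ _)))
  (let (t , tt) = cnt⇒∃ T q in cross-avoid T P (λ s r e₁ e₂ → trans (meets-sym s r) (h₁ r s e₂ e₁)) (trans e (+-suc k d)) t tt)
... | inj₁ (s , ps) | inj₁ (r , rr) with k
...   | zero = true≢false (h₄ s r ps rr) (∅-misses s r)
...   | suc k′ = ≤-pred (≤-trans (≤-trans (≤-reflexive (sym (+-suc _ _)))
        (+-monoʳ-≤ (cnt P + cnt R) (+-monoˡ-≤ (bin d (suc k′)) (bin-pos (≤-trans (n≤1+n k′) k≤d)))))
        (ih (cnt-pos P s ps) (cnt-pos R r rr)))

split-≤ : ∀ {k d} → k ≤ d → (k ≡ d) ⊎ (∃[ d′ ] (d ≡ suc d′ × k ≤ d′))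
split-≤ p with m≤n⇒m<n∨m≡n p
... | inj₁ (s≤s q) = inj₂ (_ , refl , q)
... | inj₂ e       = inj₁ e

-- Attained when one family is a single set and the other consists of all k-sets meeting it.
CrossHM : ℕ → Set
CrossHM n = ∀ k d → n ≡ k + d → k ≤ d → (A B : Family n k) → Cross A B → 1 ≤ cnt A → 1 ≤ cnt B →
  cnt A + cnt B + bin d k ≤ suc (bin n k)

-- Both families are shifted simultaneously. Once they are stable, the `inn` sections are
-- cross-intersecting too and obey `inn-bound`, the `out` sections obey the induction hypothesis,
-- and Pascal's rule adds the two.
cross-HM-step : ∀ n → CrossHM (suc n) → CrossHM (suc (suc n))
cross-HM-step n ih zero d e le A B h p q = ⊥-elim (Cross-∅ h p q)
cross-HM-step n ih (suc k) d e le A B h p q with split-≤ le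
-- Here n = 2k and C(d,k) = 1, so complementation alone gives the bound.
... | inj₁ refl = ≤-trans (+-mono-≤ (cross-bound (sym e) A B h) (≤-reflexive (bin-diag (suc k))))
                          (≤-reflexive (+-comm _ 1))
... | inj₂ (d′ , refl , le′) =
  compress (λ i → λ (X , Y) → shift i X , shift i Y) (λ i → λ (X , Y) → Stable i X × Stable i Y)
    (λ i → λ (X , Y) → shift-stable i X , shift-stable i Y)
    (λ i j → λ (X , Y) (s , t) → shift-keeps-stable i X j s , shift-keeps-stable i Y j t)
    H G advance base (sections A , sections B) (CrossS-sections h , p , q)
  where
  H G : Sections (suc n) k × Sections (suc n) k → Set
  H (X , Y) = CrossS X Y × 1 ≤ total X × 1 ≤ total Y
  G (X , Y) = total X + total Y + bin (suc d′) (suc k) ≤ suc (bin (suc (suc n)) (suc k))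
  advance : ∀ i Z → H Z → G Z ⊎ (H (shift i (proj₁ Z) , shift i (proj₂ Z)) × (G (shift i (proj₁ Z) , shift i (proj₂ Z)) → G Z))
  advance i (X , Y) (c , p , q) = inj₂ ((shift-cross i X Y c , subst (1 ≤_) (sym (shift-total i X)) p , subst (1 ≤_) (sym (shift-total i Y)) q) ,
    subst₂ (λ x y → x + y + bin (suc d′) (suc k) ≤ suc (bin (suc (suc n)) (suc k))) (shift-total i X) (shift-total i Y))
  base : ∀ Z → H Z → (∀ i → Stable i (proj₁ Z) × Stable i (proj₂ Z)) → G Z
  base (X , Y) (c , p , q) st = ≤-trans
    (merge {a = cnt (proj₁ X)} {c = cnt (proj₁ Y)}
      (inn-bound e′ k≤d′ X Y c PR Q⁺ T⁺ (ih k (suc d′) e′ (m≤n⇒m≤1+n k≤d′) (proj₁ X) (proj₁ Y) PR))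
      (ih (suc k) d′ (trans e′ (+-suc k d′)) le′ (proj₂ X) (proj₂ Y) (proj₂ (proj₂ c)) Q⁺ T⁺))
    (≤-reflexive (+-suc _ _))
    where
    e′ : suc n ≡ k + suc d′
    e′ = suc-injective e
    k≤d′ : k ≤ d′
    k≤d′ = ≤-trans (n≤1+n k) le′
    PR = stable-cross e′ X (proj₁ ∘ st) k≤d′ Y c
    Q⁺ = stable-pos e′ X (proj₁ ∘ st) p
    T⁺ = stable-pos e′ Y (proj₂ ∘ st) q

cross-HM : ∀ n → CrossHM n
cross-HM n             zero    d       e le A B h p q = ⊥-elim (Cross-∅ h p q)
cross-HM (suc zero)    (suc k) (suc d) e le = ⊥-elim (0≢1+n (trans (suc-injective e) (+-suc k d)))
cross-HM (suc (suc n)) (suc k) d       e le = cross-HM-step n (cross-HM (suc n)) (suc k) d e le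

three≤bin : ∀ k → 3 ≤ bin (suc (suc (suc k))) (suc k)
three≤bin zero    = ≤-refl
three≤bin (suc k) = ≤-trans (three≤bin k) (m≤m+n _ _)

two≤bin : ∀ k → 2 ≤ bin (suc (suc k)) (suc k)
two≤bin zero    = ≤-refl
two≤bin (suc k) = ≤-trans (two≤bin k) (m≤m+n _ _)

cross-avoid₂ : ∀ {n k} (A : Family n (suc (suc (suc k)))) (B : Family n (suc (suc k))) → Cross A B →
  n ≡ suc (suc (suc k)) + suc (suc (suc k)) → 2 ≤ cnt A →
  cnt B + (bin (suc (suc (suc k))) (suc (suc k)) + 2) ≤ bin n (suc (suc k))
cross-avoid₂ {n} {k} A B h e p with cnt⇒∃₂ A p
... | s , t , as , at , ne = ≤-trans
  (+-monoʳ-≤ (cnt B) (+-monoʳ-≤ (bin (suc (suc (suc k))) (suc (suc k))) (two≤bin k)))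
  (meet-bound₂ B s t ne (outs≡ s e) (outs≡ t e)
    (λ r e′ → trans (meets-sym r s) (h s r as e′)) (λ r e′ → trans (meets-sym r t) (h t r at e′)))

-- A version of `inn-bound` that saves 2 more, for the boundary case of `cross-HM₂-step`. The
-- surplus comes from two distinct members of an `out` section, or, if both `inn` sections are
-- nonempty, from the term of Pascal's rule that is at least 3, less the 1 in `cross-HM`.
inn-gain : ∀ {n k} → suc n ≡ suc (suc k) + suc (suc (suc (suc k))) → (X Y : Sections (suc n) (suc (suc k))) →
  CrossS X Y → Cross (proj₁ X) (proj₁ Y) → 2 ≤ cnt (proj₂ X) → 2 ≤ cnt (proj₂ Y) →
  cnt (proj₁ X) + cnt (proj₁ Y) + (bin (suc (suc (suc k))) (suc (suc k)) + 2) ≤ bin (suc n) (suc (suc k))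
inn-gain {n} {k} e (P , Q) (R , T) (h₁ , h₂ , h₃) h₄ p q with find P | find R
... | inj₂ u | _ =
  subst (λ x → x + cnt R + (bin (suc (suc (suc k))) (suc (suc k)) + 2) ≤ bin (suc n) (suc (suc k)))
    (sym (cnt-empty u)) (cross-avoid₂ Q R h₂ (trans e (+-suc (suc (suc k)) _)) p)
... | inj₁ _ | inj₂ u =
  subst (λ x → x + (bin (suc (suc (suc k))) (suc (suc k)) + 2) ≤ bin (suc n) (suc (suc k)))
    (sym (trans (cong (cnt P +_) (cnt-empty u)) (+-identityʳ _)))
    (cross-avoid₂ T P (λ s r e₁ e₂ → trans (meets-sym s r) (h₁ r s e₂ e₁)) (trans e (+-suc (suc (suc k)) _)) q)
... | inj₁ (s , ps) | inj₁ (r , rr) = ≤-pred (≤-trans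
  (≤-trans (≤-reflexive (shuffle (cnt P + cnt R) (bin (suc (suc (suc k))) (suc (suc k)))))
    (+-monoʳ-≤ (cnt P + cnt R) (+-monoˡ-≤ (bin (suc (suc (suc k))) (suc (suc k))) (three≤bin k))))
  (cross-HM (suc n) (suc (suc k)) (suc (suc (suc (suc k)))) e (m≤n⇒m≤1+n (n≤1+n _)) P R h₄ (cnt-pos P s ps) (cnt-pos R r rr)))
  where
  shuffle : ∀ x y → suc (x + (y + 2)) ≡ x + (3 + y)
  shuffle = solve-∀

-- Two members on each side improve the bound of `CrossHM` by 2; this yields the strict inequality
-- |S| > C(n-k,k).
CrossHM₂ : ℕ → Set
CrossHM₂ n = ∀ k d → n ≡ k + d → 3 ≤ k → k < d → (A B : Family n k) → Cross A B → 2 ≤ cnt A → 2 ≤ cnt B →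
  suc (cnt A + cnt B + bin d k) ≤ bin n k

cross-HM₂-step : ∀ n → CrossHM₂ (suc n) → CrossHM₂ (suc (suc n))
cross-HM₂-step n ih (suc zero) d e (s≤s ()) le A B h p q
cross-HM₂-step n ih (suc (suc zero)) d e (s≤s (s≤s ())) le A B h p q
cross-HM₂-step n ih K@(suc k@(suc (suc k′))) (suc d) e 3≤k (s≤s k<d) A B h p q =
  compress (λ i → λ (X , Y) → shift i X , shift i Y) (λ i → λ (X , Y) → Stable i X × Stable i Y)
    (λ i → λ (X , Y) → shift-stable i X , shift-stable i Y)
    (λ i j → λ (X , Y) (s , t) → shift-keeps-stable i X j s , shift-keeps-stable i Y j t)
    H G advance base (sections A , sections B) (CrossS-sections h , p , q)
  where
  H G : Sections (suc n) k × Sections (suc n) k → Set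
  H (X , Y) = CrossS X Y × 2 ≤ total X × 2 ≤ total Y
  G (X , Y) = suc (total X + total Y + bin (suc d) K) ≤ bin (suc (suc n)) K
  advance : ∀ i Z → H Z → G Z ⊎ (H (shift i (proj₁ Z) , shift i (proj₂ Z)) × (G (shift i (proj₁ Z) , shift i (proj₂ Z)) → G Z))
  advance i (X , Y) (c , p , q) = inj₂ ((shift-cross i X Y c , subst (2 ≤_) (sym (shift-total i X)) p , subst (2 ≤_) (sym (shift-total i Y)) q) ,
    subst₂ (λ x y → suc (x + y + bin (suc d) K) ≤ bin (suc (suc n)) K) (shift-total i X) (shift-total i Y))
  e′ : suc n ≡ k + suc d
  e′ = suc-injective e
  base : ∀ Z → H Z → (∀ i → Stable i (proj₁ Z) × Stable i (proj₂ Z)) → G Z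
  base (X , Y) (c , p , q) st with split-≤ k<d
  -- The ground set has 2K + 1 points, so the `out` sections live on 2K points, outside the
  -- induction hypothesis. There `cross-bound` saves nothing, and `inn-gain` has to supply
  -- everything.
  ... | inj₁ refl = ≤-trans
    (≤-reflexive (trans (cong (λ z → suc (total X + total Y + (bin (suc k) k + z))) (bin-diag K))
      (shuffle (total X + total Y) (bin (suc k) k))))
    (merge {a = cnt (proj₁ X)} {c = cnt (proj₁ Y)}
      (inn-gain e′ X Y c (stable-cross e′ X (proj₁ ∘ st) (≤-trans (n≤1+n k) k<d) Y c) Q⁺ T⁺)
      (≤-trans (≤-reflexive (+-identityʳ _)) (cross-bound (sym (trans e′ (+-suc k d))) (proj₂ X) (proj₂ Y) (proj₂ (proj₂ c)))))
    where
    shuffle : ∀ x y → suc (x + (y + 1)) ≡ x + ((y + 2) + 0)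
    shuffle = solve-∀
    Q⁺ = stable-two e′ X (proj₁ ∘ st) (≤-trans (s≤s z≤n) k<d) p
    T⁺ = stable-two e′ Y (proj₂ ∘ st) (≤-trans (s≤s z≤n) k<d) q
  ... | inj₂ (d′ , refl , k<d′) = ≤-trans
    (≤-reflexive (sym (trans (cong (total X + total Y +_) (+-suc (bin d k) _)) (+-suc (total X + total Y) _))))
    (merge {a = cnt (proj₁ X)} {c = cnt (proj₁ Y)}
      (inn-bound e′ k≤d X Y c PR (≤-trans (n≤1+n 1) Q⁺) (≤-trans (n≤1+n 1) T⁺)
        (cross-HM (suc n) k (suc d) e′ (m≤n⇒m≤1+n k≤d) (proj₁ X) (proj₁ Y) PR))
      (≤-trans (≤-reflexive (+-suc _ _)) (ih K d (trans e′ (+-suc k d)) 3≤k (s≤s k<d′) (proj₂ X) (proj₂ Y) (proj₂ (proj₂ c)) Q⁺ T⁺)))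
    where
    k≤d : k ≤ d
    k≤d = ≤-trans (n≤1+n k) k<d
    PR = stable-cross e′ X (proj₁ ∘ st) k≤d Y c
    Q⁺ = stable-two e′ X (proj₁ ∘ st) (s≤s z≤n) p
    T⁺ = stable-two e′ Y (proj₂ ∘ st) (s≤s z≤n) q

cross-HM₂ : ∀ n → CrossHM₂ n
cross-HM₂ zero          k       d       e p q = ⊥-elim (n≮0 (≤-trans p (≤-trans (m≤m+n k d) (≤-reflexive (sym e)))))
cross-HM₂ (suc zero)    k       d       e p q = ⊥-elim (n≮0 (≤-pred (≤-trans p (≤-trans (m≤m+n k d) (≤-reflexive (sym e))))))
cross-HM₂ (suc (suc n)) = cross-HM₂-step n (cross-HM₂ (suc n))

-- The Hilton-Milner theorem

meets-singleton : (s t : Sub n 1) → meets s t ≡ true → s ≡ t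
meets-singleton (inn s) (inn t) e = cong inn (∅-unique s t)
  where
  ∅-unique : ∀ {n} (s t : Sub n 0) → s ≡ t
  ∅-unique []      []      = refl
  ∅-unique (out s) (out t) = cong out (∅-unique s t)
meets-singleton (inn s) (out t) e = true≢false e (∅-misses s t)
meets-singleton (out s) (inn t) e = true≢false (trans (meets-sym t s) e) (∅-misses t s)
meets-singleton (out s) (out t) e = cong out (meets-singleton s t e)

point : (s : Sub n (suc k)) → ∃[ i ] mem i s ≡ true
point (inn s) = zero , refl
point (out s) = let (i , e) = point s in suc i , e

singletons-star : (F : Family (suc n) 1) → Cross F F → (∀ i → NonStar i F) → ⊥
singletons-star F h ns with ns zero
... | s , fs , _ with point s
... | i , e with ns i
... | t , ft , e′ with meets-singleton s t (h s t fs ft)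
... | refl = true≢false e e′

glue : Sections n k → Family (suc n) (suc k)
glue (P , Q) (inn s) = P s
glue (P , Q) (out s) = Q s

shift-fixes : (i : Fin (suc n)) (X : Sections (suc n) k) → ∀ s → proj₁ X s ≡ true → mem i s ≡ true →
  proj₁ (shift i X) s ≡ true
shift-fixes i (P , Q) s e m with view i s
... | isIn r  = cong (_∧ true) e
... | isOut r = true≢false m (mem-out i r)

-- If a shift creates a star, its centre must be the position shifted to, and then every member
-- contains the head or that position.
shift-star : (i : Fin (suc n)) (X : Sections (suc n) k) → (∀ j → NonStar j (glue X)) →
  (j : Fin (suc (suc n))) → Star j (glue (shift i X)) → Star i (proj₂ X)
shift-star i X ns zero st with ns zero
... | out s , e , _ with () ← st (out s) (shift-grows i X s e)
shift-star i X ns (suc j) st s qs with i Fin.≟ j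
... | yes refl = st (out s) (shift-grows i X s qs)
... | no ne with ns (suc j)
...   | out t , e , m = true≢false (st (out t) (shift-grows i X t e)) m
...   | inn t , e , m with mem i t in mt
...     | true  = true≢false (st (inn t) (shift-fixes i X t e mt)) m
...     | false with view i t
...       | isIn r  = true≢false (mem-in i r) mt
...       | isOut r = true≢false (st (out (inAt i r)) (shift-moves i X r e)) (trans (mem-other i j r ne) m)

-- With N = n + 1 and K = k + 1, `d` is N - K - 1 and `k ≤ d` says N ≥ 2K.
HM : ℕ → Set
HM n = ∀ k d → n ≡ suc k + d → k ≤ d → (F : Family (suc n) (suc k)) → Cross F F → (∀ i → NonStar i F) →
  cnt F + bin d k ≤ suc (bin n k)

-- Every member contains the head or `i`. Those with both number at most C(n,k-1). Those with
-- exactly one form a cross-intersecting pair of k-uniform families on n points, nonempty because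
-- neither point is a centre, so `cross-HM` applies.
two-stars-bound : ∀ {n k d} → n ≡ k + d → k ≤ d → (i : Fin (suc n)) (X : Sections (suc n) k) → CrossS X X →
  (∀ j → NonStar j (glue X)) → Star i (proj₂ X) → total X + bin d k ≤ suc (bin (suc n) k)
two-stars-bound {n} {k} {d} e k≤d i (P , Q) (h , _) ns st = ≤-trans
  (+-monoˡ-≤ (bin d k) (≤-trans (+-mono-≤ (P-bound k P) (≤-reflexive (star-cnt i Q st))) (≤-reflexive (+-assoc (extra k) _ _))))
  (≤-trans (≤-reflexive (+-assoc (extra k) _ _)) (≤-trans (+-monoʳ-≤ (extra k) main) (≤-reflexive (trans (+-suc (extra k) _) (cong suc (fold k))))))
  where
  extra : ℕ → ℕ
  extra zero    = 0
  extra (suc k) = bin n k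
  fold : ∀ k → extra k + bin n k ≡ bin (suc n) k
  fold zero    = refl
  fold (suc k) = refl
  P-bound : ∀ k (P : Family (suc n) k) → cnt P ≤ extra k + cnt (P ∘ outAt i)
  P-bound zero    P = ≤-reflexive (cnt-split₀ i P)
  P-bound (suc k) P = ≤-trans (≤-reflexive (cnt-split i P)) (+-monoˡ-≤ _ (cnt≤bin (P ∘ inAt i)))
  P⁺ : 1 ≤ cnt (P ∘ outAt i)
  P⁺ with ns (suc i)
  ... | out s , e , m = true≢false (st s e) m
  ... | inn s , e , m with view i s
  ...   | isIn r  = true≢false (mem-in i r) m
  ...   | isOut r = cnt-pos (P ∘ outAt i) r e
  Q⁺ : 1 ≤ cnt (Q ∘ inAt i)
  Q⁺ with ns zero
  ... | out s , e , m with view i s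
  ...   | isIn r  = cnt-pos (Q ∘ inAt i) r e
  ...   | isOut r = true≢false (st _ e) (mem-out i r)
  main : cnt (P ∘ outAt i) + cnt (Q ∘ inAt i) + bin d k ≤ suc (bin n k)
  main = cross-HM n k d e k≤d (P ∘ outAt i) (Q ∘ inAt i)
    (λ s t ps qt → trans (sym (meets-out-in i s t)) (h _ _ ps qt)) P⁺ Q⁺

-- By stability `Q` is not a star and `P` is intersecting. The induction hypothesis bounds `Q`. If
-- `P` is a star, a member of `Q` avoiding its centre meets all of `P`, and `star-meet-bound`
-- applies; otherwise induction bounds `P` as well.
HM-stable : ∀ n → HM n → ∀ k d → suc n ≡ k + suc (suc d) → k ≤ d → (X : Sections (suc n) k) → CrossS X X →
  (∀ i → NonStar i (glue X)) → AllStable X → total X + bin (suc d) k ≤ suc (bin (suc n) k)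
HM-stable n ih k d e k≤d X@(P , Q) c@(PQ , QP , QQ) ns st = go k refl
  where
  Q-ns : ∀ i → NonStar i Q
  Q-ns i = stable-nonStar e X st (s≤s z≤n) i (pick (ns (suc i)))
    where
    pick : NonStar (suc i) (glue X) → (∃[ s ] (P s ≡ true × mem i s ≡ false)) ⊎ NonStar i Q
    pick (inn s , p) = inj₁ (s , p)
    pick (out s , p) = inj₂ (s , p)
  PP : Cross P P
  PP = stable-cross e X st (m≤n⇒m≤1+n k≤d) X c
  Q-bound : cnt Q + bin d k ≤ suc (bin n k)
  Q-bound = ih k d (suc-injective (trans e (trans (+-suc k _) (cong suc (+-suc k d))))) k≤d Q QQ Q-ns
  go : ∀ j → k ≡ j → total X + bin (suc d) k ≤ suc (bin (suc n) k)
  go zero refl with find P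
  ... | inj₁ (s , ps) = true≢false (PP s s ps ps) (∅-misses s s)
  ... | inj₂ p = subst (λ x → x + cnt Q + 1 ≤ 2) (sym (cnt-empty p)) Q-bound
  go (suc j) refl = ≤-trans (both {a = cnt P} P-bound Q-bound) (≤-reflexive (+-suc _ _))
    where
    d≡ : suc n ≡ suc (suc j) + suc d
    d≡ = trans e (cong suc (+-suc j (suc d)))
    P-bound : cnt P + bin d j ≤ bin n j
    P-bound with anyStar? P
    ... | inj₁ (i , star) with Q-ns i
    ...   | t , qt , m = star-meet-bound i P t star m (outs≡ t d≡) (λ s ps → PQ s t ps qt)
    P-bound | inj₂ P-ns = go′ j refl
      where
      go′ : ∀ l → j ≡ l → cnt P + bin d j ≤ bin n j
      go′ zero    refl = ⊥-elim (singletons-star P PP P-ns)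
      -- Induction gives C(d+1,j) in place of C(d,j); by Pascal's rule it is larger by at least 1,
      -- which cancels the extra 1.
      go′ (suc l) refl = ≤-pred (≤-trans
        (≤-trans (≤-reflexive (sym (+-suc (cnt P) _)))
          (+-monoʳ-≤ (cnt P) (+-monoˡ-≤ (bin d (suc l)) (bin-pos (≤-trans (n≤1+n l) (≤-trans (n≤1+n (suc l)) k≤d))))))
        (ih j (suc d) (suc-injective d≡′) (≤-trans (n≤1+n j) (m≤n⇒m≤1+n k≤d)) P PP P-ns))
        where
        d≡′ : suc n ≡ suc (suc j) + suc d
        d≡′ = d≡

HM-step : ∀ n → HM n → HM (suc n)
HM-step n ih k d e le F h ns with split-≤ le
-- When N = 2K, an intersecting family has at most one set from each complementary pair.
... | inj₁ refl = ≤-trans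
  (+-mono-≤ (cross-bound (trans (+-suc k k) (sym e)) (F ∘ inn) (F ∘ out) (λ s t → h (inn s) (out t))) (≤-reflexive (bin-diag k)))
  (≤-reflexive (+-comm _ 1))
... | inj₂ (d′ , refl , k≤d′) =
  compress shift Stable shift-stable (λ i j X → shift-keeps-stable i X j) H G advance base (sections F) (CrossS-sections h , ns′)
  where
  H G : Sections (suc n) k → Set
  H X = CrossS X X × (∀ i → NonStar i (glue X))
  G X = total X + bin d k ≤ suc (bin (suc n) k)
  ns′ : ∀ i → NonStar i (glue (sections F))
  ns′ i with ns i
  ... | inn s , e , m = inn s , e , m
  ... | out s , e , m = out s , e , m
  advance : ∀ i X → H X → G X ⊎ (H (shift i X) × (G (shift i X) → G X))
  advance i X (c , ns) with anyStar? (glue (shift i X))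
  ... | inj₁ (j , st) = inj₁ (two-stars-bound (suc-injective e) le i X c ns (shift-star i X ns j st))
  ... | inj₂ ns″ = inj₂ ((shift-cross i X X c , ns″) , subst (λ x → x + bin d k ≤ suc (bin (suc n) k)) (shift-total i X))
  base : ∀ X → H X → (∀ i → Stable i X) → G X
  base X (c , ns) st = HM-stable n ih k d′ (trans e (sym (+-suc k d))) k≤d′ X c ns st

hilton-milner : ∀ n → HM n
hilton-milner zero    k d ()
hilton-milner (suc n) = HM-step n (hilton-milner n)

-- Translation to `Subset` and `card`

toS : Sub n k → Subset n
toS []      = []
toS (inn s) = true ∷ toS s
toS (out s) = false ∷ toS s

∣toS∣ : (s : Sub n k) → ∣ toS s ∣ ≡ k
∣toS∣ []      = refl
∣toS∣ (inn s) = cong suc (∣toS∣ s)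
∣toS∣ (out s) = ∣toS∣ s

encode : (p : Subset n) → ∃[ s ] toS {k = ∣ p ∣} s ≡ p
encode []          = [] , refl
encode (true ∷ p)  = let (s , e) = encode p in inn s , cong (true ∷_) e
encode (false ∷ p) = let (s , e) = encode p in out s , cong (false ∷_) e

toS-surjective : (p : Subset n) → ∣ p ∣ ≡ k → ∃[ s ] toS {k = k} s ≡ p
toS-surjective p refl = encode p

meets⇒Nonempty : (s : Sub n a) (t : Sub n b) → meets s t ≡ true → Nonempty (toS s ∩ toS t)
meets⇒Nonempty []      []      ()
meets⇒Nonempty (inn s) (inn t) e = zero , here
meets⇒Nonempty (inn s) (out t) e = let (i , p) = meets⇒Nonempty s t e in suc i , there p
meets⇒Nonempty (out s) (inn t) e = let (i , p) = meets⇒Nonempty s t e in suc i , there p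
meets⇒Nonempty (out s) (out t) e = let (i , p) = meets⇒Nonempty s t e in suc i , there p

Nonempty⇒meets : (s : Sub n a) (t : Sub n b) → Nonempty (toS s ∩ toS t) → meets s t ≡ true
Nonempty⇒meets []      []      (() , _)
Nonempty⇒meets (inn s) (inn t) _ = refl
Nonempty⇒meets (inn s) (out t) (suc i , there p) = Nonempty⇒meets s t (i , p)
Nonempty⇒meets (out s) (inn t) (suc i , there p) = Nonempty⇒meets s t (i , p)
Nonempty⇒meets (out s) (out t) (suc i , there p) = Nonempty⇒meets s t (i , p)

misses⇒Adj : (s : Sub n a) (t : Sub n b) → meets s t ≡ false → Adj (toS s) (toS t)
misses⇒Adj s t e p = true≢false (Nonempty⇒meets s t p) e

¬Adj⇒meets : (s : Sub n a) (t : Sub n b) → ¬ Adj (toS s) (toS t) → meets s t ≡ true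
¬Adj⇒meets s t h with meets s t in e
... | true  = refl
... | false = ⊥-elim (h (misses⇒Adj s t e))

Adj-sym : (p q : Subset n) → Adj p q → Adj q p
Adj-sym []         []         h (() , _)
Adj-sym (true ∷ p) (true ∷ q) h (zero , here) = h (zero , here)
Adj-sym (true ∷ p) (false ∷ q) h (zero , ())
Adj-sym (false ∷ p) (b ∷ q) h (zero , p′) = h (zero , here′ b p′)
  where
  here′ : ∀ b → ((b ∷ q) ∩ (false ∷ p)) [ zero ]= true → ((false ∷ p) ∩ (b ∷ q)) [ zero ]= true
  here′ true  ()
  here′ false ()
Adj-sym (_ ∷ p) (_ ∷ q) h (suc i , there e) = Adj-sym p q (λ { (j , e′) → h (suc j , there e′) }) (i , e)

-- `card` over an arbitrary list, so that the two halves of `allSubsets` can be treated separately.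
sizeIn : ℕ → VSet n → List (Subset n) → ℕ
sizeIn k S xs = length (filter (λ p → S p Bool.≟ true) (filter (λ p → ∣ p ∣ ≟ k) xs))

sizeIn-++ : ∀ k (S : VSet n) xs ys → sizeIn k S (xs ++ ys) ≡ sizeIn k S xs + sizeIn k S ys
sizeIn-++ k S []       ys = refl
sizeIn-++ k S (x ∷ xs) ys with does (∣ x ∣ ≟ k)
... | false = sizeIn-++ k S xs ys
... | true with does (S x Bool.≟ true)
...   | false = sizeIn-++ k S xs ys
...   | true  = cong suc (sizeIn-++ k S xs ys)

sizeIn-inn₀ : ∀ (S : VSet (suc n)) xs → sizeIn 0 S (map (true ∷_) xs) ≡ 0
sizeIn-inn₀ S []       = refl
sizeIn-inn₀ S (x ∷ xs) = sizeIn-inn₀ S xs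

sizeIn-inn : ∀ k (S : VSet (suc n)) xs → sizeIn (suc k) S (map (true ∷_) xs) ≡ sizeIn k (S ∘ (true ∷_)) xs
sizeIn-inn k S []       = refl
sizeIn-inn k S (x ∷ xs) with does (∣ x ∣ ≟ k)
... | false = sizeIn-inn k S xs
... | true with does (S (true ∷ x) Bool.≟ true)
...   | false = sizeIn-inn k S xs
...   | true  = cong suc (sizeIn-inn k S xs)

sizeIn-out : ∀ k (S : VSet (suc n)) xs → sizeIn k S (map (false ∷_) xs) ≡ sizeIn k (S ∘ (false ∷_)) xs
sizeIn-out k S []       = refl
sizeIn-out k S (x ∷ xs) with does (∣ x ∣ ≟ k)
... | false = sizeIn-out k S xs
... | true with does (S (false ∷ x) Bool.≟ true)
...   | false = sizeIn-out k S xs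
...   | true  = cong suc (sizeIn-out k S xs)

card≡cnt : ∀ n k (S : VSet n) → card k S ≡ cnt {n} {k} (S ∘ toS)
card≡cnt zero zero S with S []
... | false = refl
... | true  = refl
card≡cnt zero (suc k) S = refl
card≡cnt (suc n) zero S = trans (sizeIn-++ 0 S (map (true ∷_) (allSubsets n)) _)
  (cong₂ _+_ (sizeIn-inn₀ S (allSubsets n)) (trans (sizeIn-out 0 S (allSubsets n)) (card≡cnt n 0 (S ∘ (false ∷_)))))
card≡cnt (suc n) (suc k) S = trans (sizeIn-++ (suc k) S (map (true ∷_) (allSubsets n)) _)
  (cong₂ _+_ (trans (sizeIn-inn k S (allSubsets n)) (card≡cnt n k (S ∘ (true ∷_))))
             (trans (sizeIn-out (suc k) S (allSubsets n)) (card≡cnt n (suc k) (S ∘ (false ∷_)))))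

-- Walks, and the Erdős-Ko-Rado bound

Walk-trans : {S : VSet n} {p q r : Subset n} → Walk k S p q → Walk k S q r → Walk k S p r
Walk-trans here         w′ = w′
Walk-trans (step r a w) w′ = step r a (Walk-trans w w′)

-- A walk does not constrain its start, which becomes an end after reversal; hence the hypothesis.
Walk-sym : {S : VSet n} {p q : Subset n} → Remaining k S p → Walk k S p q → Walk k S q p
Walk-sym {n} {k} {S} = go here
  where
  go : {p q r : Subset n} → Walk k S p r → Remaining k S p → Walk k S p q → Walk k S q r
  go acc _   here = acc
  go acc rem (step {p} {q} rem′ a w) = go (step rem (Adj-sym p q a) acc) rem′ w

mem-meets : (i : Fin n) (s : Sub n a) (t : Sub n b) → mem i s ≡ true → mem i t ≡ true → meets s t ≡ true
mem-meets zero    (inn s) (inn t) _ _ = refl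
mem-meets (suc i) (inn s) (inn t) p q = refl
mem-meets (suc i) (inn s) (out t) p q = mem-meets i s t p q
mem-meets (suc i) (out s) (inn t) p q = mem-meets i s t p q
mem-meets (suc i) (out s) (out t) p q = mem-meets i s t p q

suc≤bin : ∀ {k d} → k < d → suc k ≤ bin d k
suc≤bin {zero}          _       = ≤-refl
suc≤bin {suc k} {suc d} (s≤s p) = ≤-trans (≤-reflexive (+-comm 1 (suc k))) (+-mono-≤ (suc≤bin p) (bin-pos p))

-- Stars obey the bound directly; other families obey Hilton-Milner, which is no weaker since C(d,k)
-- ≥ 1.
erdős-ko-rado : ∀ {n k d} → n ≡ k + suc d → k ≤ d → (F : Family (suc n) (suc k)) → Cross F F → cnt F ≤ bin n k
erdős-ko-rado {n} {k} {d} e k≤d F h with anyStar? F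
... | inj₁ (i , st) = star-bound i F st
... | inj₂ ns = ≤-pred (≤-trans (≤-trans (≤-reflexive (+-comm 1 _)) (+-monoʳ-≤ (cnt F) (bin-pos k≤d)))
  (hilton-milner n k d (trans e (+-suc k d)) k≤d F h ns))

⌊⌋-true : {P : Set} (p? : Dec P) → P → ⌊ p? ⌋ ≡ true
⌊⌋-true (yes _) _ = refl
⌊⌋-true (no ¬p) p = ⊥-elim (¬p p)

⌊⌋-inv : {P : Set} (p? : Dec P) → ⌊ p? ⌋ ≡ true → P
⌊⌋-inv (yes p) _ = p

not-true : ∀ {b} → not b ≡ true → b ≡ false
not-true {false} _ = refl

not-false : ∀ {b} → b ≡ false → not b ≡ true
not-false refl = refl

-- Components of the graph after deletion

module Graph (n k d : ℕ) (e : n ≡ k + suc d) (2≤k : 2 ≤ k) (k<d : k < d)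
  (S : VSet (suc n)) (c : ℕ) (comps : NumComponents (suc k) S c) where

  -- `N`, `K`, `D` are the n, k and n - k of the theorem; M is `bin n k`, X is `bin d k`, and `k<d`
  -- says N ≥ 2K + 1.
  N = suc n
  K = suc k
  D = suc d

  U : Family N K
  U s = not (S (toS s))

  rem : ∀ s → U s ≡ true → Remaining K S (toS s)
  rem s u = ∣toS∣ s , not-true u

  private
    k≤d : k ≤ d
    k≤d = ≤-trans (n≤1+n k) k<d

    reps = proj₁ comps

    rep-code : ∀ i → ∃[ s ] toS {k = K} s ≡ lookup reps i
    rep-code i = toS-surjective (lookup reps i) (proj₁ (proj₁ (proj₂ comps) i))

  f : Fin c → Sub N K
  f i = proj₁ (rep-code i)

  U-f : ∀ i → U (f i) ≡ true
  U-f i = not-false (trans (cong S (proj₂ (rep-code i))) (proj₂ (proj₁ (proj₂ comps) i)))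

  _⟶_ : Sub N K → Sub N K → Set
  s ⟶ t = Walk K S (toS s) (toS t)

  reps-apart : ∀ i j → f i ⟶ f j → i ≡ j
  reps-apart i j w with i Fin.≟ j
  ... | yes p = p
  ... | no ne = ⊥-elim (proj₁ (proj₂ (proj₂ comps)) i j ne (subst₂ (Walk K S) (proj₂ (rep-code i)) (proj₂ (rep-code j)) w))

  f-injective : ∀ i j → f i ≡ f j → i ≡ j
  f-injective i j q = reps-apart i j (subst (f i ⟶_) q here)

  locate : ∀ s → U s ≡ true → ∃[ i ] s ⟶ f i
  locate s u = let (i , w) = proj₂ (proj₂ (proj₂ comps)) (toS s) (rem s u)
               in i , subst (Walk K S (toS s)) (sym (proj₂ (rep-code i))) w

  located-unique : ∀ s i j → U s ≡ true → s ⟶ f i → s ⟶ f j → i ≡ j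
  located-unique s i j u w w′ = reps-apart i j (Walk-trans (Walk-sym (rem s u) w) w′)

  apart : ∀ s t i j → U s ≡ true → U t ≡ true → s ⟶ f i → t ⟶ f j → i ≢ j → meets s t ≡ true
  apart s t i j us ut w w′ ne = ¬Adj⇒meets s t λ a →
    ne (located-unique s i j us w (step (rem t ut) a w′))

  card+U : card K S + cnt U ≡ bin N K
  card+U = trans (cong (_+ cnt U) (card≡cnt N K S)) (cnt-not (S ∘ toS))

  ekr-card : (J : VSet N) → Independent K J → card K J ≤ bin n k
  ekr-card J ind = ≤-trans (≤-reflexive (card≡cnt N K J)) (erdős-ko-rado e k≤d (J ∘ toS)
    λ s t js jt → ¬Adj⇒meets s t (ind (toS s) (toS t) (∣toS∣ s) (∣toS∣ t) js jt))

  -- `head` is the indicator of the star at the first point; it shows that a maximum independent set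
  -- has at least M members.
  star-card : card K (head {n = n}) ≡ bin n k
  star-card = trans (card≡cnt N K head) (trans (cong₂ _+_ all none) (+-identityʳ _))
    where
    none : cnt {n} {suc k} (const false) ≡ 0
    none = cnt-empty {F = λ (_ : Sub n (suc k)) → false} λ _ → refl
    none′ : cnt {n} {k} (const false) ≡ 0
    none′ = cnt-empty {F = λ (_ : Sub n k) → false} λ _ → refl
    all : cnt {n} {k} (const true) ≡ bin n k
    all = trans (sym (+-identityʳ _)) (trans (cong (cnt {n} {k} (const true) +_) (sym none′)) (cnt-not {n} {k} (const true)))

  star-independent : Independent K (head {n = n})
  star-independent (true ∷ p) (true ∷ q) _ _ _ _ adj = adj (zero , here)

  Right : Set
  Right = D * c ≤ K * card K S × ((K * card K S ≡ D * c) ⇔ IsComplOfMaxIndep K S)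

  strict : D * c < K * card K S → (IsComplOfMaxIndep K S → ⊥) → Right
  strict p q = <⇒≤ p , mk⇔ (λ eq → ⊥-elim (<⇒≢ p (sym eq))) (λ h → ⊥-elim (q h))

  N≡K+D : N ≡ K + D
  N≡K+D = cong suc e

  compl⇒ : (h : IsComplOfMaxIndep K S) → ∀ s → U s ≡ proj₁ h (toS s)
  compl⇒ (I , _ , h) s = trans (cong not (h (toS s) (∣toS∣ s))) (Bool.not-involutive _)

  -- No surviving edge

  module NoEdge (ind : Cross U U) where

    U≡c : cnt U ≡ c
    U≡c = ≤-antisym (cnt-cover U f cover) (cnt-injective U f U-f f-injective)
      where
      toS-injective : ∀ {n k} (s t : Sub n k) → toS s ≡ toS t → s ≡ t
      toS-injective []      []      _ = refl
      toS-injective (inn s) (inn t) q = cong inn (toS-injective s t (cong tail q))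
      toS-injective (inn s) (out t) q with () ← cong head q
      toS-injective (out s) (inn t) q with () ← cong head q
      toS-injective (out s) (out t) q = cong out (toS-injective s t (cong tail q))
      stuck : ∀ s {q} → U s ≡ true → Walk K S (toS s) q → toS s ≡ q
      stuck s u here = refl
      stuck s u (step {q = q} (size , r) a w) with toS-surjective q size
      ... | t , refl = ⊥-elim (a (meets⇒Nonempty s t (ind s t u (not-false r))))
      cover : ∀ s → U s ≡ true → ∃[ i ] f i ≡ s
      cover s u = let (i , w) = locate s u in i , sym (toS-injective s (f i) (stuck s u w))

    c≤M : c ≤ bin n k
    c≤M = ≤-trans (≤-reflexive (sym U≡c)) (erdős-ko-rado e k≤d U ind)

    -- Rearranged, K|S| - Dc = N(M - c), so the bound and its equality case reduce to c ≤ M and c =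
    -- M.
    double-count : K * card K S + K * c ≡ K * bin n k + D * bin n k
    double-count = begin
      K * card K S + K * c    ≡⟨ sym (*-distribˡ-+ K _ c) ⟩
      K * (card K S + c)      ≡⟨ cong (λ z → K * (card K S + z)) (sym U≡c) ⟩
      K * (card K S + cnt U)  ≡⟨ cong (K *_) card+U ⟩
      K * bin N K             ≡⟨ bin-absorb n k ⟩
      N * bin n k             ≡⟨ cong (_* bin n k) N≡K+D ⟩
      (K + D) * bin n k       ≡⟨ *-distribʳ-+ (bin n k) K D ⟩
      K * bin n k + D * bin n k ∎
      where open ≡-Reasoning

    bound : D * c ≤ K * card K S
    bound = +-cancelʳ-≤ (K * c) _ _ (begin
      D * c + K * c              ≤⟨ +-mono-≤ (*-monoʳ-≤ D c≤M) (*-monoʳ-≤ K c≤M) ⟩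
      D * bin n k + K * bin n k  ≡⟨ +-comm (D * bin n k) _ ⟩
      K * bin n k + D * bin n k  ≡⟨ sym double-count ⟩
      K * card K S + K * c       ∎)
      where open ≤-Reasoning

    eq⇒max : K * card K S ≡ D * c → c ≡ bin n k
    eq⇒max q = *-cancelˡ-≡ c (bin n k) (K + D) (begin
      (K + D) * c              ≡⟨ *-distribʳ-+ c K D ⟩
      K * c + D * c            ≡⟨ cong (K * c +_) (sym q) ⟩
      K * c + K * card K S     ≡⟨ +-comm (K * c) _ ⟩
      K * card K S + K * c     ≡⟨ double-count ⟩
      K * bin n k + D * bin n k ≡⟨ sym (*-distribʳ-+ (bin n k) K D) ⟩
      (K + D) * bin n k        ∎)
      where open ≡-Reasoning

    max⇒eq : c ≡ bin n k → K * card K S ≡ D * c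
    max⇒eq q = +-cancelʳ-≡ (K * c) _ _ (begin
      K * card K S + K * c      ≡⟨ double-count ⟩
      K * bin n k + D * bin n k ≡⟨ cong (λ z → K * z + D * z) (sym q) ⟩
      K * c + D * c             ≡⟨ +-comm (K * c) _ ⟩
      D * c + K * c             ∎)
      where open ≡-Reasoning

    right : Right
    right = bound , mk⇔ to from
      where
      to : K * card K S ≡ D * c → IsComplOfMaxIndep K S
      to q = not ∘ S , (indep , maximal) , λ p _ → sym (Bool.not-involutive (S p))
        where
        indep : Independent K (not ∘ S)
        indep p p′ s s′ u u′ a with toS-surjective p s | toS-surjective p′ s′
        ... | t , refl | t′ , refl = a (meets⇒Nonempty t t′ (ind t t′ u u′))
        maximal : ∀ J → Independent K J → card K J ≤ card K (not ∘ S)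
        maximal J i = ≤-trans (ekr-card J i) (≤-reflexive (trans (sym (eq⇒max q)) (trans (sym U≡c) (sym (card≡cnt N K (not ∘ S))))))
      from : IsComplOfMaxIndep K S → K * card K S ≡ D * c
      from h@(I , (_ , mx) , _) = max⇒eq (≤-antisym c≤M (≤-trans (≤-reflexive (sym star-card))
        (≤-trans (mx head star-independent) (≤-reflexive (trans (card≡cnt N K I) (trans (cnt-cong (sym ∘ compl⇒ h)) U≡c))))))

  -- A surviving edge

  module Edge (u v : Sub N K) (Uu : U u ≡ true) (Uv : U v ≡ true) (uv : meets u v ≡ false) where

    u⟶ = locate u Uu
    i₀ = proj₁ u⟶

    v⟶ : v ⟶ f i₀
    v⟶ = step (rem u Uu) (misses⇒Adj v u (trans (meets-sym v u) uv)) (proj₂ u⟶)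

    ¬compl : IsComplOfMaxIndep K S → ⊥
    ¬compl h@(I , (ind , _) , _) = ind (toS u) (toS v) (∣toS∣ u) (∣toS∣ v)
      (trans (sym (compl⇒ h u)) Uu) (trans (sym (compl⇒ h v)) Uv) (misses⇒Adj u v uv)

    class : ∀ s → (∃[ i ] (U s ≡ true × s ⟶ f i)) ⊎ U s ≡ false
    class s with U s in q
    ... | false = inj₂ refl
    ... | true  = let (i , w) = locate s q in inj₁ (i , refl , w)

    inA inB : ∀ {s} → (∃[ i ] (U s ≡ true × s ⟶ f i)) ⊎ U s ≡ false → Bool
    inA (inj₁ (i , _)) = ⌊ i Fin.≟ i₀ ⌋
    inA (inj₂ _)       = false
    inB (inj₁ (i , _)) = not ⌊ i Fin.≟ i₀ ⌋
    inB (inj₂ _)       = false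

    A B : Family N K
    A s = inA (class s)
    B s = inB (class s)

    A-intro : ∀ s → U s ≡ true → s ⟶ f i₀ → A s ≡ true
    A-intro s us w with class s
    ... | inj₁ (i , us′ , w′) = ⌊⌋-true _ (located-unique s i i₀ us w′ w)
    ... | inj₂ q = true≢false us q

    A-elim : ∀ s → A s ≡ true → U s ≡ true × s ⟶ f i₀
    A-elim s q with class s
    ... | inj₁ (i , us , w) with i Fin.≟ i₀
    ...   | yes refl = us , w

    B-intro : ∀ s j → U s ≡ true → s ⟶ f j → j ≢ i₀ → B s ≡ true
    B-intro s j us w ne with class s
    ... | inj₂ q = true≢false us q
    ... | inj₁ (i , us′ , w′) with i Fin.≟ i₀
    ...   | yes p = ⊥-elim (ne (trans (located-unique s j i us w w′) p))
    ...   | no _  = refl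

    B-elim : ∀ s → B s ≡ true → ∃[ j ] (U s ≡ true × s ⟶ f j × j ≢ i₀)
    B-elim s q with class s
    ... | inj₁ (i , us , w) with i Fin.≟ i₀
    ...   | no ne = i , us , w , ne

    A+B : cnt A + cnt B ≡ cnt U
    A+B = trans (sym (cnt-∧∨ A B)) (cong₂ _+_ (cnt-empty disj) (cnt-cong cover))
      where
      disj : ∀ s → A s ∧ B s ≡ false
      disj s with class s
      ... | inj₂ _ = refl
      ... | inj₁ (i , _) with i Fin.≟ i₀
      ...   | yes _ = refl
      ...   | no _  = refl
      cover : ∀ s → A s ∨ B s ≡ U s
      cover s with class s
      ... | inj₂ q = sym q
      ... | inj₁ (i , us , _) with i Fin.≟ i₀
      ...   | yes _ = sym us
      ...   | no _  = sym us

    AB : Cross A B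
    AB s t as bt with A-elim s as | B-elim t bt
    ... | us , w | j , ut , w′ , ne = apart s t i₀ j us ut w w′ (ne ∘ sym)

    A-two : 2 ≤ cnt A
    A-two = cnt-two A (A-intro u Uu (proj₂ u⟶)) (A-intro v Uv v⟶) λ { refl → true≢false (meets-self u) uv }

    card≥ : ∀ {x} → x + cnt U ≤ bin N K → x ≤ card K S
    card≥ {x} p = +-cancelʳ-≤ (cnt U) x (card K S) (≤-trans p (≤-reflexive (sym card+U)))

    B-large : ∀ {c′} → c ≡ suc c′ → c′ ≤ cnt B
    B-large refl = cnt-injective B (f ∘ punchIn i₀)
      (λ j → B-intro _ (punchIn i₀ j) (U-f _) here (Fin.punchInᵢ≢i i₀ j))
      (λ j j′ q → Fin.punchIn-injective i₀ j j′ (f-injective _ _ q))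

    few : c ≤ bin d k → (∀ {c′} → c ≡ suc c′ → 1 ≤ c′) → Right
    few c≤X c≥2 = strict (lem (pos i₀)) ¬compl
      where
      pos : ∀ {c} → Fin c → ∃[ c′ ] c ≡ suc c′
      pos {suc c} _ = c , refl
      absorb : K * bin D K ≡ D * bin d k
      absorb = bin-absorb d k
      lem : (∃[ c′ ] c ≡ suc c′) → D * c < K * card K S
      lem (c′ , c≡) with 2 ≤? cnt B
      -- Strictness comes from `cross-HM₂`, which gives |S| ≥ C(D,K) + 1.
      ... | yes p = begin-strict
        D * c            ≤⟨ *-monoʳ-≤ D c≤X ⟩
        D * bin d k      ≡⟨ sym absorb ⟩
        K * bin D K      <⟨ *-monoʳ-< K (card≥ {suc (bin D K)} (≤-trans
                              (≤-reflexive (cong suc (trans (+-comm (bin D K) _) (cong (_+ bin D K) (sym A+B)))))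
                              (cross-HM₂ N K D N≡K+D (s≤s 2≤k) (s≤s k<d) A B AB A-two p))) ⟩
        K * card K S     ∎
        where open ≤-Reasoning
      -- Only |S| ≥ C(D,K) is available, from the single vertex outside the component of the edge;
      -- strictness comes from c ≤ 2 < K ≤ X.
      ... | no ¬p = begin-strict
        D * c            <⟨ *-monoʳ-< D (≤-trans (≤-trans (s≤s c≤2) (s≤s 2≤k)) (suc≤bin k<d)) ⟩
        D * bin d k      ≡⟨ sym absorb ⟩
        K * bin D K      ≤⟨ *-monoʳ-≤ K (card≥ (≤-trans (≤-reflexive (+-comm (bin D K) _)) avoid)) ⟩
        K * card K S     ∎
        where
        open ≤-Reasoning
        B≤1 : cnt B ≤ 1
        B≤1 = ≤-pred (≰⇒> ¬p)
        c≤2 : c ≤ 2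
        c≤2 = ≤-trans (≤-reflexive c≡) (s≤s (≤-trans (B-large c≡) B≤1))
        avoid : cnt U + bin D K ≤ bin N K
        avoid with cnt⇒∃ B (≤-trans (c≥2 c≡) (B-large c≡))
        ... | t , bt with B-elim t bt
        ... | j , ut , w , ne = subst (λ x → cnt U + bin x K ≤ bin N K) (outs≡ t N≡K+D) (meet-bound U t all-meet)
          where
          all-meet : ∀ s → U s ≡ true → meets s t ≡ true
          all-meet s us with locate s us
          ... | i , w′ with i Fin.≟ i₀
          ...   | yes refl = apart s t i j us ut w′ w (ne ∘ sym)
          ...   | no ne′ with s ≟ₛ t
          ...     | yes refl = meets-self s
          ...     | no s≢t = ⊥-elim (¬p (cnt-two B (B-intro s i us w′ ne′) bt s≢t))

    R : Family N K
    R s = ⌊ Fin.any? (λ i → f i ≟ₛ s) ⌋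

    R-f : ∀ i → R (f i) ≡ true
    R-f i = ⌊⌋-true (Fin.any? _) (i , refl)

    R-elim : ∀ s → R s ≡ true → ∃[ i ] f i ≡ s
    R-elim s = ⌊⌋-inv (Fin.any? (λ i → f i ≟ₛ s))

    R-cross : Cross R R
    R-cross s t rs rt with R-elim s rs | R-elim t rt
    ... | i , refl | j , refl with i Fin.≟ j
    ...   | yes refl = meets-self (f i)
    ...   | no ne    = apart _ _ i j (U-f i) (U-f j) here here ne

    -- A non-star falls under Hilton-Milner. For a star centred at `y`, one of the disjoint sets
    -- `u`, `v` misses `y`; every representative but `f i₀` lies in another component, hence meets
    -- that set, and `star-meet-bound` gives c - 1 ≤ M - X.
    many : c + bin d k ≤ suc (bin n k)
    many with anyStar? R
    ... | inj₂ ns = ≤-trans (+-monoˡ-≤ (bin d k) (cnt-injective R f R-f f-injective))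
                            (hilton-milner n k d (trans e (+-suc k d)) k≤d R R-cross ns)
    ... | inj₁ (y , st) = ≤-trans (+-monoˡ-≤ (bin d k) (≤-trans (cnt-injective R f R-f f-injective) (≤-reflexive (cnt-∖ R (f i₀) (R-f i₀)))))
                                  (s≤s rest)
      where
      R′ : Family N K
      R′ = R ∖ f i₀
      via : ∀ w → U w ≡ true → w ⟶ f i₀ → mem y w ≡ false → cnt R′ + bin d k ≤ bin n k
      via w uw ww m = star-meet-bound y R′ w (λ s q → st s (proj₁ (∖⇒ R (f i₀) s q))) m (outs≡ w N≡K+D) meet
        where
        meet : ∀ s → R′ s ≡ true → meets s w ≡ true
        meet s q with ∖⇒ R (f i₀) s q
        ... | rs , ne with R-elim s rs
        ...   | j , refl = apart _ w j i₀ (U-f j) uw here ww λ { refl → ne refl }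
      rest : cnt R′ + bin d k ≤ bin n k
      rest with mem y u in mu
      ... | false = via u Uu (proj₂ u⟶) mu
      ... | true with mem y v in mv
      ...   | false = via v Uv v⟶ mv
      ...   | true  = true≢false (mem-meets y u v mu mv) uv

  -- Assembling the cases

  edge? : (∃[ u ] ∃[ v ] (U u ≡ true × U v ≡ true × meets u v ≡ false)) ⊎ Cross U U
  edge? with anySub? (λ u → anySub? (λ v → (U u Bool.≟ true) ×-dec (U v Bool.≟ true) ×-dec (meets u v Bool.≟ false)))
  ... | yes p = inj₁ p
  ... | no ¬p = inj₂ λ s t us ut → Bool.¬-not λ q → ¬p (s , t , us , ut , q)

  main : IsVertexCut K S → (bin d k + 1 ≤ c × c ≤ (bin n k ∸ bin d k) + 1) ⊎ Right
  main (p , q , rp , rq , ¬w) with edge?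
  ... | inj₂ ind = inj₂ (NoEdge.right ind)
  ... | inj₁ (u , v , uu , uv , m) with c ≤? bin d k
  ...   | yes p≤ = inj₂ (Edge.few u v uu uv m p≤ c≥2)
    where
    c≥2 : ∀ {c′} → c ≡ suc c′ → 1 ≤ c′
    c≥2 {suc c′} _ = s≤s z≤n
    -- With a single component, the two vertices separated by the cut would both be joined to its
    -- representative.
    c≥2 {zero} refl with toS-surjective p (proj₁ rp) | toS-surjective q (proj₁ rq)
    ... | s , refl | t , refl with locate s (not-false (proj₂ rp)) | locate t (not-false (proj₂ rq))
    ...   | zero , w | zero , w′ = ⊥-elim (¬w (Walk-trans w (Walk-sym rq w′)))
  ...   | no ¬p = inj₁ (≤-trans (≤-reflexive (+-comm _ 1)) (≰⇒> ¬p) ,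
          ≤-trans (m+n≤o⇒m≤o∸n c (Edge.many u v uu uv m)) (≤-trans (m≤n+o⇒m∸n≤o (suc (bin n k)) (bin d k) fits) (≤-reflexive (+-comm 1 _))))
    where
    fits : suc (bin n k) ≤ bin d k + suc (bin n k ∸ bin d k)
    fits = ≤-trans (s≤s (m≤n+m∸n (bin n k) (bin d k))) (≤-reflexive (sym (+-suc _ _)))

theorem18 : (n k : ℕ) → 3 ≤ k → 2 * k + 1 ≤ n →
    (S : VSet n) → IsVertexCut k S →
    (c : ℕ) → NumComponents k S c →
    ((((n ∸ k) ∸ 1) C (k ∸ 1)) + 1 ≤ c × c ≤ (((n ∸ 1) C (k ∸ 1)) ∸ (((n ∸ k) ∸ 1) C (k ∸ 1))) + 1)
    ⊎ ((n ∸ k) * c ≤ k * card k S × ((k * card k S ≡ (n ∸ k) * c) ⇔ IsComplOfMaxIndep k S))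
theorem18 (suc n) (suc k) (s≤s 2≤k) 2k+1≤n S cut c comps with m≤n⇒∃[o]m+o≡n 2k+1≤n
... | o , eq =
  -- Here `o` is the excess of the number of points over 2K + 1 with K = `suc k`, which makes `d`
  -- equal to `suc k + o`.
  subst (λ D → Goal ((D ∸ 1) C k) (n C k) D) (sym (trans (cong (_∸ k) n≡) (m+n∸m≡n k (suc (suc k + o)))))
    (subst₂ (λ X M → Goal X M (suc (suc k + o))) (bin≡C (suc k + o) k) (bin≡C n k)
      (Graph.main n k (suc k + o) n≡ 2≤k (m≤m+n (suc k) o) S c comps cut))
  where
  n≡ : n ≡ k + suc (suc k + o)
  n≡ = suc-injective (trans (sym eq) (e k o))
    where
    e : ∀ k o → 2 * suc k + 1 + o ≡ suc (k + suc (suc k + o))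
    e = solve-∀
  Goal : ℕ → ℕ → ℕ → Set
  Goal X M D = (X + 1 ≤ c × c ≤ (M ∸ X) + 1)
    ⊎ (D * c ≤ suc k * card (suc k) S × ((suc k * card (suc k) S ≡ D * c) ⇔ IsComplOfMaxIndep (suc k) S))
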